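{- Let $k\geq t+2\geq 4$ and $n\geq t+(k-t)\cdot\max\{18(t+2),\,2ek\}$. If $\mathcal{F}\subseteq\binom{[n]}{k}$ is $t$-intersecting, then $$\gamma_t(\mathcal{F})\leq\gamma_t(\mathcal{A}(n,k,t)).$$ If equality holds, then $\mathcal{F}\subseteq\mathcal{A}(Z)$ for some $Z\in\binom{[n]}{t+2}$.
   Context: $n,k,t$ are positive integers, $[n]=\{1,\dots,n\}$, $\binom{[n]}{k}$ is the family of all $k$-subsets of $[n]$, and $e$ is the base of the natural logarithm. A family $\mathcal{F}$ is $t$-intersecting if $|F\cap F'|\ge t$ for all $F,F'\in\mathcal{F}$. For a family $\mathcal{F}$ of subsets of $[n]$, $\Delta_t(\mathcal{F})=\max\{|\{F\in\mathcal{F}:S\subseteq F\}|:S\in\binom{[n]}{t}\}$ and the $t$-diversity is $\gamma_t(\mathcal{F}):=|\mathcal{F}|-\Delta_t(\mathcal{F})$. For $Z\in\binom{[n]}{t+2}$, $\mathcal{A}(Z)=\{F\in\binom{[n]}{k}:|F\cap Z|\geq t+1\}$, and $\mathcal{A}(n,k,t)=\mathcal{A}([t+2])$; one has $\gamma_t(\mathcal{A}(n,k,t))=t\binom{n-t-2}{k-t-1}$. -}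

module Defs where

open import Data.Bool.Base using (Bool; T; _∧_)
open import Data.Fin.Base using (toℕ)
open import Data.Fin.Subset using (Subset; inside; outside; ∣_∣; _∩_)
open import Data.Fin.Subset.Properties using (_⊆?_)
open import Data.Integer.Base using (+_)
open import Data.List.Base using (List; [_]; map; _++_; filter; filterᵇ; length)
open import Data.List.Extrema.Nat using (max)
open import Data.Nat.Base as ℕ using (ℕ; zero; suc; _∸_; _!)
open import Data.Nat.Properties using (_≟_; _≤?_; _<?_; _!≢0)
open import Data.Rational.Base as ℚ using (ℚ; 1ℚ)
open import Data.Vec.Base using (_∷_; []; tabulate)
open import Relation.Binary.PropositionalEquality using (_≡_)
open import Relation.Nullary.Decidable using (⌊_⌋; _×-dec_)

-- The ground set [n] is Fin n: the index i stands for the element i + 1.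

-- All subsets of [n], each listed exactly once.
subsets : ∀ n → List (Subset n)
subsets zero    = [ [] ]
subsets (suc n) = map (outside ∷_) (subsets n) ++ map (inside ∷_) (subsets n)

ksubsets : ∀ n → ℕ → List (Subset n)
ksubsets n k = filter (λ S → ∣ S ∣ ≟ k) (subsets n)

-- A family of subsets of [n], given by its characteristic function.
Family : ℕ → Set
Family n = Subset n → Bool

infix 4 _∈ᶠ_ _⊆ᶠ_

_∈ᶠ_ : ∀ {n} → Subset n → Family n → Set
A ∈ᶠ 𝓕 = T (𝓕 A)

_⊆ᶠ_ : ∀ {n} → Family n → Family n → Set
𝓕 ⊆ᶠ 𝓖 = ∀ A → A ∈ᶠ 𝓕 → A ∈ᶠ 𝓖

card : ∀ {n} → Family n → ℕ
card {n} 𝓕 = length (filterᵇ 𝓕 (subsets n))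

Uniform : ∀ {n} → ℕ → Family n → Set
Uniform k 𝓕 = ∀ A → A ∈ᶠ 𝓕 → ∣ A ∣ ≡ k

Intersecting : ∀ {n} → ℕ → Family n → Set
Intersecting t 𝓕 = ∀ A B → A ∈ᶠ 𝓕 → B ∈ᶠ 𝓕 → t ℕ.≤ ∣ A ∩ B ∣

star : ∀ {n} → Subset n → Family n → Family n
star S 𝓕 A = 𝓕 A ∧ ⌊ S ⊆? A ⌋

-- The 0 is only the value of the maximum over an empty range, i.e. for t > n.
Δ : ∀ {n} → ℕ → Family n → ℕ
Δ {n} t 𝓕 = max 0 (map (λ S → card (star S 𝓕)) (ksubsets n t))

-- Δ t 𝓕 ≤ card 𝓕 always holds, so the subtraction is never truncated.
γ : ∀ {n} → ℕ → Family n → ℕ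
γ t 𝓕 = card 𝓕 ∸ Δ t 𝓕

𝓐[_] : ∀ {n} → Subset n → ℕ → ℕ → Family n
𝓐[ Z ] k t A = ⌊ (∣ A ∣ ≟ k) ×-dec (t ℕ.+ 1 ≤? ∣ A ∩ Z ∣) ⌋

-- The subset {1, …, m} of [n] (all of [n] when m > n).
initial : ∀ n → ℕ → Subset n
initial n m = tabulate (λ i → ⌊ toℕ i <? m ⌋)

𝓐 : ∀ n → ℕ → ℕ → Family n
𝓐 n k t = 𝓐[ initial n (t ℕ.+ 2) ] k t

fromℕ : ℕ → ℚ
fromℕ n = + n ℚ./ 1

1/_! : ℕ → ℚ
1/ i ! = ℚ._/_ (+ 1) (i !) {{i !≢0}}

-- Σ_{i ≤ m} 1/i!, increasing in m with supremum and limit e.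
eSum : ℕ → ℚ
eSum zero    = 1/ 0 !
eSum (suc m) = eSum m ℚ.+ 1/ suc m !

-- q ≥ f(e) for a continuous nondecreasing f, given on ℚ: for such f,
-- f(e) is the supremum of the values f(Σ_{i ≤ m} 1/i!).
_≥[e]_ : ℚ → (ℚ → ℚ) → Set
q ≥[e] f = ∀ m → f (eSum m) ℚ.≤ q

-- t + (k - t) · max{18(t+2), 2xk}; for k ≥ t it is continuous and
-- nondecreasing in x.
bound : ℕ → ℕ → ℚ → ℚ
bound k t x =
  fromℕ t ℚ.+ (fromℕ k ℚ.- fromℕ t) ℚ.*
    (fromℕ (18 ℕ.* (t ℕ.+ 2)) ℚ.⊔ (fromℕ 2 ℚ.* x ℚ.* fromℕ k))

{-# OPTIONS --safe #-}
module Submission where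

open import Defs
open import Data.Bool.Base using (Bool; true; false; T; _∧_; not; if_then_else_)
open import Data.Bool.Properties using (T-∧; T-≡)
import Data.Bool.Properties as Bool
open import Data.Empty using (⊥-elim)
open import Data.Fin.Base using (Fin; zero; suc; toℕ)
import Data.Fin.Properties as Fin
open import Data.Fin.Subset
open import Data.Fin.Subset.Properties
import Data.Integer.Base as ℤ
import Data.Integer.Properties as ℤ
open import Data.List.Base as List using (List; []; _∷_; length; filterᵇ; map; allFin; _++_)
open import Data.List.Extrema.Nat using (max≤v⁺; v≤max⁺)
import Data.List.Membership.Propositional as List
open import Data.List.Membership.Propositional.Properties using (∈-map⁺; ∈-++⁺ˡ; ∈-++⁺ʳ; ∈-filter⁺; ∈-filter⁻)
open import Data.List.Properties using (length-++; filter-++)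
import Data.List.Relation.Unary.All as All
import Data.List.Relation.Unary.All.Properties as All
import Data.List.Relation.Unary.Any as Any
open import Data.Nat.Base hiding (∣_-_∣)
open import Data.Nat.Combinatorics using (_C_; nCk+nC[k+1]≡[n+1]C[k+1]; k>n⇒nCk≡0; nCk≡nC[n∸k]; nC1≡n)
open import Data.Nat.ListAction using (sum)
open import Data.Nat.Properties
open import Data.Nat.Tactic.RingSolver using (solve-∀)
open import Data.Product.Base using (_×_; _,_; ∃-syntax; proj₁; proj₂)
open import Data.Rational.Base as ℚ using (ℚ; 1ℚ; toℚᵘ)
import Data.Rational.Properties as ℚ
open import Data.Rational.Solver using (module +-*-Solver)
open import Data.Rational.Unnormalised.Base as ℚᵘ using (mkℚᵘ; *≡*; *≤*; _≃_)
import Data.Rational.Unnormalised.Properties as ℚᵘ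
open import Data.Sum.Base using (_⊎_; inj₁; inj₂; [_,_]′)
open import Data.Vec.Base as Vec using ([]; _∷_; lookup; here; there)
import Data.Vec.Properties as Vec
open import Function.Base using (_∘_; id; case_of_)
open import Function.Bundles using (Equivalence)
open import Relation.Binary.PropositionalEquality
  using (_≡_; _≢_; refl; sym; trans; cong; cong₂; subst; subst₂; module ≡-Reasoning)
open import Relation.Nullary
open import Relation.Nullary.Decidable
  using (⌊_⌋; toWitness; fromWitness; _×-dec_; _⊎-dec_; T?; ¬?; decidable-stable; toSum; isYes≗does)

-- Write r = k - t and N = n - t. Starting from 𝓕 and going down from q = k, replace members of size q
-- by proper subsets for as long as the family stays t-intersecting, and then discard the remaining
-- ones. Those are irreducible: every proper subset of such a W meets some member in fewer than t
-- points. Since members have size at most q = t + j, branching over such members shows that there are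
-- at most C(t+j,t)(j+1)^j of them, and hence at most C(t+j,t)(j+1)^j C(N-j,r-j) sets of 𝓕 are lost at
-- this level. As (1 + 1/m)^m ≤ e and N ≥ 2ekr, this at least halves from each j to j + 1, so all
-- levels j ≥ 2 together lose at most twice the loss at j = 2.
-- What remains is a t-intersecting family of sets of size at most t + 1. Either its members share a
-- t-set, and then 𝓕 has tiny diversity, or they all lie in some Z with |Z| = t + 2. In the second
-- case, either 𝓕 ⊆ 𝓐(Z), or some G ∈ 𝓕 meets Z in at most t points; then for a t-set S with
-- G ∩ Z ⊆ S ⊆ Z every A ∈ 𝓕 with A ∩ Z = Z - x, x ∈ S, has to meet G outside Z, which makes such A rare.

-- The yardstick is tD with D = C(N-2,r-1), a lower bound for the diversity of `𝓐 n k t`. Peeling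
-- stops at size t + 1 because discarding that size too would be charged 2(t+1)C(N-1,r-1), which
-- exceeds tD; these sets are handled by structure instead of counting. The deeper levels cost at
-- most 2 · 9 · C(t+2,2) · C(N-2,r-2), where 9 is (j+1)^j at j = 2. Since C(N-2,r-2) ≤ (r/N)D, the
-- condition N ≥ 18(t+2)r turns this into (t+1)D/2, which is at most (3/4)tD because t ≥ 2. The
-- exceptional sets of the last case cost at most tk C(N-3,r-2) ≤ (kr/N)tD ≤ (2/9)tD, by (3/2)^2 ≤
-- e. As 3/4 + 2/9 = 35/36, every case except 𝓕 ⊆ 𝓐(Z) ends strictly below tD, and the equality
-- statement follows at once. The number e is never formed: the m-th partial sum of its series
-- already bounds (1 + 1/m)^m, so each inequality needed is one between natural numbers.

private variable
  n : ℕ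
  I J : Set

-- Subsets of `Fin n` and their sizes

⊆-or-witness : (p q : Subset n) → p ⊆ q ⊎ ∃[ x ] (x ∈ p × x ∉ q)
⊆-or-witness [] [] = inj₁ λ ()
⊆-or-witness (inside ∷ p) (outside ∷ q) = inj₂ (zero , here , λ ())
⊆-or-witness (outside ∷ p) (s ∷ q) with ⊆-or-witness p q
... | inj₁ p⊆q = inj₁ (out⊆ p⊆q)
... | inj₂ (x , x∈p , x∉q) = inj₂ (suc x , there x∈p , x∉q ∘ drop-there)
⊆-or-witness (inside ∷ p) (inside ∷ q) with ⊆-or-witness p q
... | inj₁ p⊆q = inj₁ (in⊆in p⊆q)
... | inj₂ (x , x∈p , x∉q) = inj₂ (suc x , there x∈p , x∉q ∘ drop-there)

⊆∧∣∣≥⇒≡ : {p q : Subset n} → p ⊆ q → ∣ q ∣ ≤ ∣ p ∣ → p ≡ q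
⊆∧∣∣≥⇒≡ {p = p} {q} p⊆q q≤p with ⊆-or-witness q p
... | inj₁ q⊆p = ⊆-antisym p⊆q q⊆p
... | inj₂ w   = ⊥-elim (<⇒≱ (p⊂q⇒∣p∣<∣q∣ (p⊆q , w)) q≤p)

∣p∪q∣+∣p∩q∣≡∣p∣+∣q∣ : (p q : Subset n) → ∣ p ∪ q ∣ + ∣ p ∩ q ∣ ≡ ∣ p ∣ + ∣ q ∣
∣p∪q∣+∣p∩q∣≡∣p∣+∣q∣ [] [] = refl
∣p∪q∣+∣p∩q∣≡∣p∣+∣q∣ (outside ∷ p) (outside ∷ q) = ∣p∪q∣+∣p∩q∣≡∣p∣+∣q∣ p q
∣p∪q∣+∣p∩q∣≡∣p∣+∣q∣ (outside ∷ p) (inside ∷ q) =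
  trans (cong suc (∣p∪q∣+∣p∩q∣≡∣p∣+∣q∣ p q)) (sym (+-suc ∣ p ∣ ∣ q ∣))
∣p∪q∣+∣p∩q∣≡∣p∣+∣q∣ (inside ∷ p) (outside ∷ q) = cong suc (∣p∪q∣+∣p∩q∣≡∣p∣+∣q∣ p q)
∣p∪q∣+∣p∩q∣≡∣p∣+∣q∣ (inside ∷ p) (inside ∷ q) = cong suc
  (trans (+-suc ∣ p ∪ q ∣ ∣ p ∩ q ∣) (trans (cong suc (∣p∪q∣+∣p∩q∣≡∣p∣+∣q∣ p q)) (sym (+-suc ∣ p ∣ ∣ q ∣))))

∣p─q∣+∣p∩q∣≡∣p∣ : (p q : Subset n) → ∣ p ─ q ∣ + ∣ p ∩ q ∣ ≡ ∣ p ∣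
∣p─q∣+∣p∩q∣≡∣p∣ [] [] = refl
∣p─q∣+∣p∩q∣≡∣p∣ (outside ∷ p) (outside ∷ q) = ∣p─q∣+∣p∩q∣≡∣p∣ p q
∣p─q∣+∣p∩q∣≡∣p∣ (outside ∷ p) (inside ∷ q) = ∣p─q∣+∣p∩q∣≡∣p∣ p q
∣p─q∣+∣p∩q∣≡∣p∣ (inside ∷ p) (outside ∷ q) = cong suc (∣p─q∣+∣p∩q∣≡∣p∣ p q)
∣p─q∣+∣p∩q∣≡∣p∣ (inside ∷ p) (inside ∷ q) =
  trans (+-suc ∣ p ─ q ∣ ∣ p ∩ q ∣) (cong suc (∣p─q∣+∣p∩q∣≡∣p∣ p q))

x∈p─q⇒x∉q : (p q : Subset n) {x : Fin n} → x ∈ p ─ q → x ∉ q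
x∈p─q⇒x∉q (_ ∷ p) (inside ∷ q) (there x∈) (there x∈q) = x∈p─q⇒x∉q p q x∈ x∈q
x∈p─q⇒x∉q (_ ∷ p) (outside ∷ q) (there x∈) (there x∈q) = x∈p─q⇒x∉q p q x∈ x∈q

x∈p-y⇒x≢y : {p : Subset n} {x y : Fin n} → x ∈ p - y → x ≢ y
x∈p-y⇒x≢y {p = p} {y = y} x∈ refl = x∈p─q⇒x∉q p ⁅ y ⁆ x∈ (x∈⁅x⁆ y)

p-x⊆p : (p : Subset n) (x : Fin n) → p - x ⊆ p
p-x⊆p p x = p─q⊆p p ⁅ x ⁆

⁅x⁆⊆ : {p : Subset n} {x : Fin n} → x ∈ p → ⁅ x ⁆ ⊆ p
⁅x⁆⊆ {x = x} x∈p y∈ rewrite x∈⁅y⁆⇒x≡y x y∈ = x∈p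

∪-⊆ : {p q r : Subset n} → p ⊆ r → q ⊆ r → p ∪ q ⊆ r
∪-⊆ {p = p} {q} p⊆r q⊆r x∈ = [ p⊆r , q⊆r ]′ (x∈p∪q⁻ p q x∈)

⊆-∩ : {p q r : Subset n} → r ⊆ p → r ⊆ q → r ⊆ p ∩ q
⊆-∩ r⊆p r⊆q x∈ = x∈p∩q⁺ (r⊆p x∈ , r⊆q x∈)

p⊆q⇒p∩q≡p : {p q : Subset n} → p ⊆ q → p ∩ q ≡ p
p⊆q⇒p∩q≡p {p = p} {q} p⊆q = ⊆-antisym (p∩q⊆p p q) (⊆-∩ id p⊆q)

suc∣p-x∣≡∣p∣ : {p : Subset n} {x : Fin n} → x ∈ p → suc ∣ p - x ∣ ≡ ∣ p ∣
suc∣p-x∣≡∣p∣ {p = p} {x} x∈p = begin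
  suc ∣ p - x ∣                ≡⟨ +-comm 1 _ ⟩
  ∣ p - x ∣ + 1                ≡⟨ cong (∣ p - x ∣ +_) (∣⁅x⁆∣≡1 x) ⟨
  ∣ p - x ∣ + ∣ ⁅ x ⁆ ∣        ≡⟨ cong (λ s → ∣ p - x ∣ + ∣ s ∣) (trans (∩-comm p ⁅ x ⁆) (p⊆q⇒p∩q≡p (⁅x⁆⊆ x∈p))) ⟨
  ∣ p - x ∣ + ∣ p ∩ ⁅ x ⁆ ∣    ≡⟨ ∣p─q∣+∣p∩q∣≡∣p∣ p ⁅ x ⁆ ⟩
  ∣ p ∣                        ∎
  where open ≡-Reasoning

Empty⇒∣p∣≡0 : {p : Subset n} → Empty p → ∣ p ∣ ≡ 0
Empty⇒∣p∣≡0 {n} e rewrite Empty-unique e = ∣⊥∣≡0 n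

∣p∪⁅x⁆∣≡suc∣p∣ : {p : Subset n} {x : Fin n} → x ∉ p → ∣ p ∪ ⁅ x ⁆ ∣ ≡ suc ∣ p ∣
∣p∪⁅x⁆∣≡suc∣p∣ {p = p} {x} x∉p = begin
  ∣ p ∪ ⁅ x ⁆ ∣                      ≡⟨ +-identityʳ _ ⟨
  ∣ p ∪ ⁅ x ⁆ ∣ + 0                  ≡⟨ cong (∣ p ∪ ⁅ x ⁆ ∣ +_) (Empty⇒∣p∣≡0 disjoint) ⟨
  ∣ p ∪ ⁅ x ⁆ ∣ + ∣ p ∩ ⁅ x ⁆ ∣      ≡⟨ ∣p∪q∣+∣p∩q∣≡∣p∣+∣q∣ p ⁅ x ⁆ ⟩
  ∣ p ∣ + ∣ ⁅ x ⁆ ∣                  ≡⟨ cong (∣ p ∣ +_) (∣⁅x⁆∣≡1 x) ⟩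
  ∣ p ∣ + 1                          ≡⟨ +-comm _ 1 ⟩
  suc ∣ p ∣                          ∎
  where
  open ≡-Reasoning
  disjoint : Empty (p ∩ ⁅ x ⁆)
  disjoint (y , y∈) with x∈p∩q⁻ p ⁅ x ⁆ y∈
  ... | y∈p , y∈x rewrite x∈⁅y⁆⇒x≡y x y∈x = x∉p y∈p

interpolate : {p q : Subset n} {m : ℕ} → p ⊆ q → ∣ p ∣ ≤ m → m ≤ ∣ q ∣ →
              ∃[ r ] (p ⊆ r × r ⊆ q × ∣ r ∣ ≡ m)
interpolate {p = []} {[]} {zero} _ _ _ = [] , id , id , refl
interpolate {p = inside ∷ p} {outside ∷ q} p⊆q _ _ with () ← p⊆q here
interpolate {p = inside ∷ p} {inside ∷ q} {suc m} p⊆q (s≤s p≤m) (s≤s m≤q)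
  with r , p⊆r , r⊆q , eq ← interpolate (drop-∷-⊆ p⊆q) p≤m m≤q
  = inside ∷ r , in⊆in p⊆r , in⊆in r⊆q , cong suc eq
interpolate {p = outside ∷ p} {outside ∷ q} p⊆q p≤m m≤q
  with r , p⊆r , r⊆q , eq ← interpolate (drop-∷-⊆ p⊆q) p≤m m≤q
  = outside ∷ r , out⊆ p⊆r , out⊆ r⊆q , eq
interpolate {p = outside ∷ p} {inside ∷ q} {m} p⊆q p≤m m≤q with m ≤? ∣ q ∣
... | yes m≤∣q∣
  with r , p⊆r , r⊆q , eq ← interpolate (drop-∷-⊆ p⊆q) p≤m m≤∣q∣
  = outside ∷ r , out⊆ p⊆r , out⊆ r⊆q , eq
-- Points are left out while the rest of `q` can still supply `m` of them. Here it cannot, so `m` is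
-- `suc ∣ q ∣` and all of the larger set is taken.
... | no m≰∣q∣
  = inside ∷ q , out⊆ (drop-∷-⊆ p⊆q) , id , ≤-antisym (≰⇒> m≰∣q∣) m≤q

∈-tabulate⁺ : {f : Fin n → Bool} {x : Fin n} → T (f x) → x ∈ Vec.tabulate f
∈-tabulate⁺ {f = f} {x} fx =
  Vec.lookup⇒[]= x _ (trans (Vec.lookup∘tabulate f x) (Equivalence.to T-≡ fx))

∈-tabulate⁻ : {f : Fin n → Bool} {x : Fin n} → x ∈ Vec.tabulate f → T (f x)
∈-tabulate⁻ {f = f} {x} x∈ =
  Equivalence.from T-≡ (trans (sym (Vec.lookup∘tabulate f x)) (Vec.[]=⇒lookup x∈))

∈⇒T-lookup : {p : Subset n} {x : Fin n} → x ∈ p → T (lookup p x)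
∈⇒T-lookup x∈p = Equivalence.from T-≡ (Vec.[]=⇒lookup x∈p)

T-lookup⇒∈ : {p : Subset n} {x : Fin n} → T (lookup p x) → x ∈ p
T-lookup⇒∈ px = Vec.lookup⇒[]= _ _ (Equivalence.to T-≡ px)

subsingleton⇒∣p∣≤1 : {p : Subset n} → (∀ {x y} → x ∈ p → y ∈ p → x ≡ y) → ∣ p ∣ ≤ 1
subsingleton⇒∣p∣≤1 {p = p} unique with nonempty? p
... | no e = ≤-trans (≤-reflexive (Empty⇒∣p∣≡0 e)) z≤n
... | yes (x , x∈p) = subst (∣ p ∣ ≤_) (∣⁅x⁆∣≡1 x)
  (p⊆q⇒∣p∣≤∣q∣ λ y∈p → subst (_∈ ⁅ x ⁆) (unique x∈p y∈p) (x∈⁅x⁆ x))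

-- Double counting

cnt : (I → Bool) → List I → ℕ
cnt p xs = length (filterᵇ p xs)

ι : Bool → ℕ
ι b = if b then 1 else 0

cnt-∷ : (p : I → Bool) (x : I) (xs : List I) → cnt p (x ∷ xs) ≡ ι (p x) + cnt p xs
cnt-∷ p x xs with p x
... | true  = refl
... | false = refl

ι-mono : {a b : Bool} → (T a → T b) → ι a ≤ ι b
ι-mono {false} _ = z≤n
ι-mono {true} {true} _ = ≤-refl
ι-mono {true} {false} f = ⊥-elim (f _)

cnt-mono : {p q : I → Bool} → (∀ x → T (p x) → T (q x)) → ∀ xs → cnt p xs ≤ cnt q xs
cnt-mono p⇒q [] = z≤n
cnt-mono {p = p} {q} p⇒q (x ∷ xs) rewrite cnt-∷ p x xs | cnt-∷ q x xs =
  +-mono-≤ (ι-mono (p⇒q x)) (cnt-mono p⇒q xs)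

cnt-++ : (p : I → Bool) (xs ys : List I) → cnt p (xs ++ ys) ≡ cnt p xs + cnt p ys
cnt-++ p xs ys = trans (cong length (filter-++ (T? ∘ p) xs ys)) (length-++ (filterᵇ p xs))

cnt-map : (p : J → Bool) (f : I → J) (xs : List I) → cnt p (map f xs) ≡ cnt (p ∘ f) xs
cnt-map p f [] = refl
cnt-map p f (x ∷ xs) rewrite cnt-∷ p (f x) (map f xs) | cnt-∷ (p ∘ f) x xs =
  cong (ι (p (f x)) +_) (cnt-map p f xs)

cnt-empty : {p : I → Bool} → (∀ x → ¬ T (p x)) → ∀ xs → cnt p xs ≡ 0
cnt-empty ¬p [] = refl
cnt-empty {p = p} ¬p (x ∷ xs) with p x | ¬p x
... | false | _ = cnt-empty ¬p xs
... | true  | ¬px = ⊥-elim (¬px _)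

cnt-tabulate : (p : I → Bool) (f : Fin n → I) → cnt p (List.tabulate f) ≡ ∣ Vec.tabulate (p ∘ f) ∣
cnt-tabulate {n = zero} p f = refl
cnt-tabulate {n = suc n} p f with p (f zero)
... | true  = cong suc (cnt-tabulate p (f ∘ suc))
... | false = cnt-tabulate p (f ∘ suc)

cnt-allFin : (p : Fin n → Bool) → cnt p (allFin n) ≡ ∣ Vec.tabulate p ∣
cnt-allFin p = cnt-tabulate p id

∣p∣≡cnt : (p : Subset n) → ∣ p ∣ ≡ cnt (lookup p) (allFin n)
∣p∣≡cnt p = sym (trans (cnt-allFin (lookup p)) (cong ∣_∣ (Vec.tabulate∘lookup p)))

sum-map-+ : (f g : I → ℕ) (xs : List I) →
            sum (map (λ x → f x + g x) xs) ≡ sum (map f xs) + sum (map g xs)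
sum-map-+ f g [] = refl
sum-map-+ f g (x ∷ xs) rewrite sum-map-+ f g xs =
  lem (f x) (g x) (sum (map f xs)) (sum (map g xs))
  where
  lem : ∀ a b c d → a + b + (c + d) ≡ a + c + (b + d)
  lem = solve-∀

sum-map-mono : {f g : I → ℕ} → (∀ x → f x ≤ g x) → ∀ xs → sum (map f xs) ≤ sum (map g xs)
sum-map-mono f≤g [] = z≤n
sum-map-mono f≤g (x ∷ xs) = +-mono-≤ (f≤g x) (sum-map-mono f≤g xs)

sum-map-ι : (p : I → Bool) (c : ℕ) (xs : List I) → sum (map (λ x → ι (p x) * c) xs) ≡ cnt p xs * c
sum-map-ι p c [] = refl
sum-map-ι p c (x ∷ xs) rewrite cnt-∷ p x xs | sum-map-ι p c xs =
  sym (*-distribʳ-+ c (ι (p x)) (cnt p xs))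

sum-cnt-swap : (R : I → J → Bool) (xs : List I) (ys : List J) →
  sum (map (λ x → cnt (R x) ys) xs) ≡ sum (map (λ y → cnt (λ x → R x y) xs) ys)
sum-cnt-swap R [] [] = refl
sum-cnt-swap R [] (y ∷ ys) = sum-cnt-swap R [] ys
sum-cnt-swap R (x ∷ xs) ys = begin
  cnt (R x) ys + sum (map (λ x → cnt (R x) ys) xs)
    ≡⟨ cong₂ _+_ (trans (sym (*-identityʳ _)) (sym (sum-map-ι (R x) 1 ys))) (sum-cnt-swap R xs ys) ⟩
  sum (map (λ y → ι (R x y) * 1) ys) + sum (map (λ y → cnt (λ x → R x y) xs) ys)
    ≡⟨ sum-map-+ (λ y → ι (R x y) * 1) _ ys ⟨
  sum (map (λ y → ι (R x y) * 1 + cnt (λ x → R x y) xs) ys)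
    ≡⟨ cong sum (map-cong′ ys) ⟩
  sum (map (λ y → cnt (λ x → R x y) (x ∷ xs)) ys) ∎
  where
  open ≡-Reasoning
  map-cong′ : ∀ zs → map (λ y → ι (R x y) * 1 + cnt (λ x → R x y) xs) zs ≡ map (λ y → cnt (λ x → R x y) (x ∷ xs)) zs
  map-cong′ [] = refl
  map-cong′ (z ∷ zs) = cong₂ _∷_
    (trans (cong (_+ cnt (λ x → R x z) xs) (*-identityʳ _)) (sym (cnt-∷ (λ x → R x z) x xs)))
    (map-cong′ zs)

T-∧⁺ : {a b : Bool} → T a → T b → T (a ∧ b)
T-∧⁺ ta tb = Equivalence.from T-∧ (ta , tb)

T-∧⁻ : {a b : Bool} → T (a ∧ b) → T a × T b
T-∧⁻ = Equivalence.to T-∧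

-- The incidences `Φ` are summed by rows and by columns. The multiplicity `i` is kept, since a plain
-- union bound (`i` = 1) would lose the binomial coefficient in the branching argument.
double-count-≤ : (X : I → Bool) (xs : List I) (Φ : I → J → Bool) (F : J → Bool) (ys : List J) (i B : ℕ) →
  (∀ x → T (X x) → cnt (Φ x) ys ≤ B) →
  (∀ y → T (F y) → i ≤ cnt (λ x → X x ∧ Φ x y) xs) →
  i * cnt F ys ≤ cnt X xs * B
double-count-≤ X xs Φ F ys i B up low = begin
  i * cnt F ys                                            ≡⟨ *-comm i _ ⟩
  cnt F ys * i                                            ≡⟨ sum-map-ι F i ys ⟨
  sum (map (λ y → ι (F y) * i) ys)                        ≤⟨ sum-map-mono low′ ys ⟩
  sum (map (λ y → cnt (λ x → X x ∧ Φ x y) xs) ys)         ≡⟨ sum-cnt-swap (λ x y → X x ∧ Φ x y) xs ys ⟨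
  sum (map (λ x → cnt (λ y → X x ∧ Φ x y) ys) xs)         ≤⟨ sum-map-mono up′ xs ⟩
  sum (map (λ x → ι (X x) * B) xs)                        ≡⟨ sum-map-ι X B xs ⟩
  cnt X xs * B                                            ∎
  where
  open ≤-Reasoning
  low′ : ∀ y → ι (F y) * i ≤ cnt (λ x → X x ∧ Φ x y) xs
  low′ y with F y | low y
  ... | false | _ = z≤n
  ... | true  | h = ≤-trans (≤-reflexive (+-identityʳ i)) (h _)
  up′ : ∀ x → cnt (λ y → X x ∧ Φ x y) ys ≤ ι (X x) * B
  up′ x with X x | up x
  ... | false | _ = ≤-reflexive (cnt-empty (λ _ ()) ys)
  ... | true  | h = ≤-trans (h _) (≤-reflexive (sym (+-identityʳ B)))

double-count-≥ : (X : I → Bool) (xs : List I) (Φ : I → J → Bool) (F : J → Bool) (ys : List J) (B : ℕ) →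
  (∀ x → T (X x) → B ≤ cnt (Φ x) ys) →
  (∀ y → cnt (λ x → X x ∧ Φ x y) xs ≤ ι (F y)) →
  cnt X xs * B ≤ cnt F ys
double-count-≥ X xs Φ F ys B low up = begin
  cnt X xs * B                                            ≡⟨ sum-map-ι X B xs ⟨
  sum (map (λ x → ι (X x) * B) xs)                        ≤⟨ sum-map-mono low′ xs ⟩
  sum (map (λ x → cnt (λ y → X x ∧ Φ x y) ys) xs)         ≡⟨ sum-cnt-swap (λ x y → X x ∧ Φ x y) xs ys ⟩
  sum (map (λ y → cnt (λ x → X x ∧ Φ x y) xs) ys)         ≤⟨ sum-map-mono up′ ys ⟩
  sum (map (λ y → ι (F y) * 1) ys)                        ≡⟨ sum-map-ι F 1 ys ⟩
  cnt F ys * 1                                            ≡⟨ *-identityʳ _ ⟩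
  cnt F ys                                                ∎
  where
  open ≤-Reasoning
  low′ : ∀ x → ι (X x) * B ≤ cnt (λ y → X x ∧ Φ x y) ys
  low′ x with X x | low x
  ... | false | _ = z≤n
  ... | true  | h = ≤-trans (≤-reflexive (+-identityʳ B)) (h _)
  up′ : ∀ y → cnt (λ x → X x ∧ Φ x y) xs ≤ ι (F y) * 1
  up′ y = ≤-trans (up y) (≤-reflexive (sym (*-identityʳ _)))

-- Counting members of families

private variable
  𝓕 𝓖 𝓗 : Family n

card-mono : 𝓕 ⊆ᶠ 𝓖 → card 𝓕 ≤ card 𝓖
card-mono {n} 𝓕⊆𝓖 = cnt-mono 𝓕⊆𝓖 (subsets n)

card-suc : (𝓕 : Family (suc n)) → card 𝓕 ≡ card (𝓕 ∘ (outside ∷_)) + card (𝓕 ∘ (inside ∷_))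
card-suc {n} 𝓕 = trans
  (cnt-++ 𝓕 (map (outside ∷_) (subsets n)) (map (inside ∷_) (subsets n)))
  (cong₂ _+_ (cnt-map 𝓕 (outside ∷_) (subsets n)) (cnt-map 𝓕 (inside ∷_) (subsets n)))

card-mono-< : {𝓕 𝓖 : Family n} → 𝓕 ⊆ᶠ 𝓖 → (A : Subset n) → A ∈ᶠ 𝓖 → ¬ A ∈ᶠ 𝓕 → card 𝓕 < card 𝓖
card-mono-< {𝓕 = 𝓕} {𝓖} ⊆ [] A∈𝓖 A∉𝓕 with 𝓕 [] | 𝓖 []
... | false | true = s≤s z≤n
... | true  | _    = ⊥-elim (A∉𝓕 _)
card-mono-< {𝓕 = 𝓕} {𝓖} ⊆ (outside ∷ A) A∈𝓖 A∉𝓕 rewrite card-suc 𝓕 | card-suc 𝓖 =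
  +-mono-<-≤ (card-mono-< (⊆ ∘ (outside ∷_)) A A∈𝓖 A∉𝓕) (card-mono (⊆ ∘ (inside ∷_)))
card-mono-< {𝓕 = 𝓕} {𝓖} ⊆ (inside ∷ A) A∈𝓖 A∉𝓕 rewrite card-suc 𝓕 | card-suc 𝓖 =
  +-mono-≤-< (card-mono (⊆ ∘ (outside ∷_))) (card-mono-< (⊆ ∘ (inside ∷_)) A A∈𝓖 A∉𝓕)

card-empty : {𝓕 : Family n} → (∀ A → ¬ A ∈ᶠ 𝓕) → card 𝓕 ≡ 0
card-empty {n} ∉𝓕 = cnt-empty ∉𝓕 (subsets n)

card-pos : {𝓕 : Family n} (A : Subset n) → A ∈ᶠ 𝓕 → 1 ≤ card 𝓕
card-pos A A∈𝓕 = ≤-<-trans z≤n (card-mono-< {𝓕 = λ _ → false} (λ _ ()) A A∈𝓕 id)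

card-cover : (𝓕 𝓖 𝓗 : Family n) → (∀ A → A ∈ᶠ 𝓕 → A ∈ᶠ 𝓖 ⊎ A ∈ᶠ 𝓗) → card 𝓕 ≤ card 𝓖 + card 𝓗
card-cover {n} 𝓕 𝓖 𝓗 cover = go (subsets n)
  where
  ι-cover : ∀ {a b c} → (T a → T b ⊎ T c) → ι a ≤ ι b + ι c
  ι-cover {false} _ = z≤n
  ι-cover {true} {true} _ = s≤s z≤n
  ι-cover {true} {false} {true} _ = s≤s z≤n
  ι-cover {true} {false} {false} f = [ ⊥-elim , ⊥-elim ]′ (f _)
  rearrange : ∀ a b c d → a + b + (c + d) ≡ a + c + (b + d)
  rearrange = solve-∀
  go : ∀ xs → cnt 𝓕 xs ≤ cnt 𝓖 xs + cnt 𝓗 xs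
  go [] = z≤n
  go (x ∷ xs) rewrite cnt-∷ 𝓕 x xs | cnt-∷ 𝓖 x xs | cnt-∷ 𝓗 x xs =
    ≤-trans (+-mono-≤ (ι-cover (cover x)) (go xs))
      (≤-reflexive (rearrange (ι (𝓖 x)) (ι (𝓗 x)) (cnt 𝓖 xs) (cnt 𝓗 xs)))

-- The `i` incidences of `A` are given as a point set `Y`, because in the branching they form an
-- intersection of sets whose size is known.
double-count-points : (X : Subset n) (Φ : Fin n → Family n) (𝓕 : Family n) (i B : ℕ) →
  (∀ x → x ∈ X → card (Φ x) ≤ B) →
  (∀ A → A ∈ᶠ 𝓕 → ∃[ Y ] (i ≤ ∣ Y ∣ × (∀ {x} → x ∈ Y → x ∈ X × A ∈ᶠ Φ x))) →
  i * card 𝓕 ≤ ∣ X ∣ * B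
double-count-points {n} X Φ 𝓕 i B up low rewrite ∣p∣≡cnt X =
  double-count-≤ (lookup X) (allFin n) Φ 𝓕 (subsets n) i B (λ x → up x ∘ T-lookup⇒∈) low′
  where
  low′ : ∀ A → A ∈ᶠ 𝓕 → i ≤ cnt (λ x → lookup X x ∧ Φ x A) (allFin n)
  low′ A A∈𝓕 with Y , i≤Y , Y⇒ ← low A A∈𝓕 rewrite cnt-allFin (λ x → lookup X x ∧ Φ x A) =
    ≤-trans i≤Y (p⊆q⇒∣p∣≤∣q∣ λ x∈Y → ∈-tabulate⁺ (T-∧⁺ (∈⇒T-lookup (proj₁ (Y⇒ x∈Y))) (proj₂ (Y⇒ x∈Y))))

union-bound-points : (X : Subset n) (Φ : Fin n → Family n) (𝓕 : Family n) (B : ℕ) →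
  (∀ x → x ∈ X → card (Φ x) ≤ B) →
  (∀ A → A ∈ᶠ 𝓕 → ∃[ x ] (x ∈ X × A ∈ᶠ Φ x)) →
  card 𝓕 ≤ ∣ X ∣ * B
union-bound-points X Φ 𝓕 B up cover = subst (_≤ ∣ X ∣ * B) (+-identityʳ _)
  (double-count-points X Φ 𝓕 1 B up λ A A∈𝓕 → case cover A A∈𝓕 of λ
    { (x , x∈X , A∈Φ) → ⁅ x ⁆ , ≤-reflexive (sym (∣⁅x⁆∣≡1 x)) ,
      λ {_} y∈ → subst (λ y → y ∈ X × A ∈ᶠ Φ y) (sym (x∈⁅y⁆⇒x≡y x y∈)) (x∈X , A∈Φ) })

disjoint-union-points : (X : Subset n) (Φ : Fin n → Family n) (𝓕 : Family n) (B : ℕ) →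
  (∀ x → x ∈ X → B ≤ card (Φ x)) →
  (∀ {x A} → x ∈ X → A ∈ᶠ Φ x → A ∈ᶠ 𝓕) →
  (∀ {x y A} → x ∈ X → y ∈ X → A ∈ᶠ Φ x → A ∈ᶠ Φ y → x ≡ y) →
  ∣ X ∣ * B ≤ card 𝓕
disjoint-union-points {n} X Φ 𝓕 B low Φ⊆𝓕 disjoint rewrite ∣p∣≡cnt X =
  double-count-≥ (lookup X) (allFin n) Φ 𝓕 (subsets n) B (λ x → low x ∘ T-lookup⇒∈) up
  where
  members : ∀ {A x} → x ∈ Vec.tabulate (λ x → lookup X x ∧ Φ x A) → x ∈ X × A ∈ᶠ Φ x
  members x∈ = case T-∧⁻ (∈-tabulate⁻ x∈) of λ { (x∈X , A∈) → T-lookup⇒∈ x∈X , A∈ }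
  up : ∀ A → cnt (λ x → lookup X x ∧ Φ x A) (allFin n) ≤ ι (𝓕 A)
  up A rewrite cnt-allFin (λ x → lookup X x ∧ Φ x A) with 𝓕 A | (λ x → Φ⊆𝓕 {x} {A})
  ... | true  | _ = subsingleton⇒∣p∣≤1 λ x∈ y∈ →
    disjoint (proj₁ (members x∈)) (proj₁ (members y∈)) (proj₂ (members {A} x∈)) (proj₂ (members y∈))
  ... | false | ∉𝓕 = ≤-reflexive (Empty⇒∣p∣≡0 λ { (x , x∈) → ∉𝓕 x (proj₁ (members x∈)) (proj₂ (members x∈)) })

union-bound-family : (𝓦 : Family n) (Φ : Subset n → Family n) (𝓕 : Family n) (B : ℕ) →
  (∀ W → W ∈ᶠ 𝓦 → card (Φ W) ≤ B) →
  (∀ A → A ∈ᶠ 𝓕 → ∃[ W ] (W ∈ᶠ 𝓦 × A ∈ᶠ Φ W)) →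
  card 𝓕 ≤ card 𝓦 * B
union-bound-family {n} 𝓦 Φ 𝓕 B up cover = subst (_≤ card 𝓦 * B) (+-identityʳ _)
  (double-count-≤ 𝓦 (subsets n) Φ 𝓕 (subsets n) 1 B up λ A A∈𝓕 → case cover A A∈𝓕 of λ
    { (W , W∈𝓦 , A∈Φ) → card-pos {𝓕 = λ W → 𝓦 W ∧ Φ W A} W (T-∧⁺ W∈𝓦 A∈Φ) })

-- Sets of size `k` with a prescribed trace

infix 4 _≟ˢ_
_≟ˢ_ : (p q : Subset n) → Dec (p ≡ q)
_≟ˢ_ = Vec.≡-dec Bool._≟_

traces : ℕ → Subset n → Subset n → Family n
traces k Q P A = ⌊ (∣ A ∣ ≟ k) ×-dec (A ∩ Q ≟ˢ P) ⌋

card-cong : 𝓕 ⊆ᶠ 𝓖 → 𝓖 ⊆ᶠ 𝓕 → card 𝓕 ≡ card 𝓖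
card-cong 𝓕⊆𝓖 𝓖⊆𝓕 = ≤-antisym (card-mono 𝓕⊆𝓖) (card-mono 𝓖⊆𝓕)

∈traces⁺ : {k : ℕ} {Q P A : Subset n} → ∣ A ∣ ≡ k → A ∩ Q ≡ P → A ∈ᶠ traces k Q P
∈traces⁺ {k = k} {Q} {P} {A} ∣A∣ A∩Q = fromWitness {a? = (∣ A ∣ ≟ k) ×-dec (A ∩ Q ≟ˢ P)} (∣A∣ , A∩Q)

∈traces⁻ : {k : ℕ} {Q P A : Subset n} → A ∈ᶠ traces k Q P → ∣ A ∣ ≡ k × A ∩ Q ≡ P
∈traces⁻ {k = k} {Q} {P} {A} A∈ = toWitness {a? = (∣ A ∣ ≟ k) ×-dec (A ∩ Q ≟ˢ P)} A∈

card-traces-outside : (k : ℕ) (s : Side) (Q P : Subset n) →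
  card (traces k (s ∷ Q) (outside ∷ P) ∘ (outside ∷_)) ≡ card (traces k Q P)
card-traces-outside k s Q P = card-cong {𝓕 = traces k (s ∷ Q) (outside ∷ P) ∘ (outside ∷_)}
  (λ A A∈ → let eq , eq′ = ∈traces⁻ {k = k} {s ∷ Q} {outside ∷ P} {outside ∷ A} A∈ in
    ∈traces⁺ eq (Vec.∷-injectiveʳ eq′))
  (λ A A∈ → let eq , eq′ = ∈traces⁻ {k = k} {Q} {P} {A} A∈ in
    ∈traces⁺ {Q = s ∷ Q} {A = outside ∷ A} eq (cong (outside ∷_) eq′))

card-traces-inside : (k : ℕ) (s : Side) (Q P : Subset n) →
  card (traces (suc k) (s ∷ Q) (s ∷ P) ∘ (inside ∷_)) ≡ card (traces k Q P)
card-traces-inside k s Q P = card-cong {𝓕 = traces (suc k) (s ∷ Q) (s ∷ P) ∘ (inside ∷_)}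
  (λ A A∈ → let eq , eq′ = ∈traces⁻ {k = suc k} {s ∷ Q} {s ∷ P} {inside ∷ A} A∈ in
    ∈traces⁺ (suc-injective eq) (Vec.∷-injectiveʳ eq′))
  (λ A A∈ → let eq , eq′ = ∈traces⁻ {k = k} {Q} {P} {A} A∈ in
    ∈traces⁺ {Q = s ∷ Q} {A = inside ∷ A} (cong suc eq) (cong (s ∷_) eq′))

-- Here a elements remain to be chosen among the b points outside Q.
card-traces : {Q P : Subset n} {a b k : ℕ} → P ⊆ Q → ∣ P ∣ + a ≡ k → ∣ Q ∣ + b ≡ n →
              card (traces k Q P) ≡ b C a
card-traces {Q = []} {[]} {zero} _ refl refl = refl
card-traces {Q = []} {[]} {suc a} _ refl refl = refl
card-traces {Q = outside ∷ _} {inside ∷ _} P⊆Q _ _ with () ← P⊆Q here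
card-traces {Q = inside ∷ Q} {inside ∷ P} {a} {b} {suc k} P⊆Q eqₖ eqₙ = begin
  card 𝓣                                                  ≡⟨ card-suc 𝓣 ⟩
  card (𝓣 ∘ (outside ∷_)) + card (𝓣 ∘ (inside ∷_))        ≡⟨ cong₂ _+_ none (card-traces-inside k inside Q P) ⟩
  card (traces k Q P)                                     ≡⟨ card-traces (drop-∷-⊆ P⊆Q) (suc-injective eqₖ) (suc-injective eqₙ) ⟩
  b C a                                                   ∎
  where
  open ≡-Reasoning
  𝓣 : Family _
  𝓣 = traces (suc k) (inside ∷ Q) (inside ∷ P)
  none : card (𝓣 ∘ (outside ∷_)) ≡ 0
  none = card-empty λ A A∈ → case proj₂ (∈traces⁻ {k = suc k} {inside ∷ Q} {inside ∷ P} {outside ∷ A} A∈) of λ ()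
card-traces {Q = inside ∷ Q} {outside ∷ P} {a} {b} {k} P⊆Q eqₖ eqₙ = begin
  card 𝓣                                                  ≡⟨ card-suc 𝓣 ⟩
  card (𝓣 ∘ (outside ∷_)) + card (𝓣 ∘ (inside ∷_))        ≡⟨ cong₂ _+_ (card-traces-outside k inside Q P) none ⟩
  card (traces k Q P) + 0                                 ≡⟨ +-identityʳ _ ⟩
  card (traces k Q P)                                     ≡⟨ card-traces (drop-∷-⊆ P⊆Q) eqₖ (suc-injective eqₙ) ⟩
  b C a                                                   ∎
  where
  open ≡-Reasoning
  𝓣 : Family _
  𝓣 = traces k (inside ∷ Q) (outside ∷ P)
  none : card (𝓣 ∘ (inside ∷_)) ≡ 0
  none = card-empty λ A A∈ → case proj₂ (∈traces⁻ {k = k} {inside ∷ Q} {outside ∷ P} {inside ∷ A} A∈) of λ ()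
card-traces {n = suc n} {Q = outside ∷ Q} {outside ∷ P} {a} {zero} P⊆Q eqₖ eqₙ =
  ⊥-elim (<⇒≱ (s≤s (∣p∣≤n Q)) (≤-reflexive (trans (sym eqₙ) (+-identityʳ _))))
card-traces {n = suc n} {Q = outside ∷ Q} {outside ∷ P} {a} {suc b} {k} P⊆Q eqₖ eqₙ = begin
  card 𝓣                                                  ≡⟨ card-suc 𝓣 ⟩
  card (𝓣 ∘ (outside ∷_)) + card (𝓣 ∘ (inside ∷_))        ≡⟨ cong (_+ card (𝓣 ∘ (inside ∷_))) (card-traces-outside k outside Q P) ⟩
  card (traces k Q P) + card (𝓣 ∘ (inside ∷_))            ≡⟨ cong (_+ card (𝓣 ∘ (inside ∷_))) (card-traces (drop-∷-⊆ P⊆Q) eqₖ eqₙ′) ⟩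
  b C a + card (𝓣 ∘ (inside ∷_))                          ≡⟨ inside-part a k eqₖ ⟩
  suc b C a                                               ∎
  where
  open ≡-Reasoning
  𝓣 : Family _
  𝓣 = traces k (outside ∷ Q) (outside ∷ P)
  eqₙ′ : ∣ Q ∣ + b ≡ n
  eqₙ′ = suc-injective (trans (sym (+-suc ∣ Q ∣ b)) eqₙ)
  -- With `a` = 0 the trace alone has size `k`, so no set can contain the new point; otherwise that
  -- point uses up one of the `a` choices, as in Pascal's rule.
  inside-part : ∀ a k → ∣ P ∣ + a ≡ k →
    b C a + card (traces k (outside ∷ Q) (outside ∷ P) ∘ (inside ∷_)) ≡ suc b C a
  inside-part zero k eqₖ = cong (b C 0 +_) (card-empty λ A A∈ →
    let eq , eq′ = ∈traces⁻ {k = k} {outside ∷ Q} {outside ∷ P} {inside ∷ A} A∈ in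
    <⇒≱ (s≤s (subst (λ p → ∣ p ∣ ≤ ∣ A ∣) (Vec.∷-injectiveʳ eq′) (∣p∩q∣≤∣p∣ A Q)))
        (≤-reflexive (trans eq (trans (sym eqₖ) (+-identityʳ _)))))
  inside-part (suc a) zero eqₖ = ⊥-elim (1+n≢0 (trans (sym (+-suc ∣ P ∣ a)) eqₖ))
  inside-part (suc a) (suc k) eqₖ = begin
    b C suc a + card (traces (suc k) (outside ∷ Q) (outside ∷ P) ∘ (inside ∷_))
      ≡⟨ cong (b C suc a +_) (card-traces-inside k outside Q P) ⟩
    b C suc a + card (traces k Q P)
      ≡⟨ cong (b C suc a +_) (card-traces (drop-∷-⊆ P⊆Q) (suc-injective (trans (sym (+-suc ∣ P ∣ a)) eqₖ)) eqₙ′) ⟩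
    b C suc a + b C a
      ≡⟨ +-comm (b C suc a) (b C a) ⟩
    b C a + b C suc a
      ≡⟨ nCk+nC[k+1]≡[n+1]C[k+1] b a ⟩
    suc b C suc a ∎

-- Binomial coefficients

-- The absorption identity. Later ratios of neighbouring binomial coefficients all come from it or
-- from the variant that follows.
[1+k]*[1+n]C[1+k]≡[1+n]*nCk : ∀ n k → suc k * (suc n C suc k) ≡ suc n * (n C k)
[1+k]*[1+n]C[1+k]≡[1+n]*nCk zero zero = refl
[1+k]*[1+n]C[1+k]≡[1+n]*nCk zero (suc k) = begin
  suc (suc k) * (1 C suc (suc k))   ≡⟨ cong (suc (suc k) *_) (k>n⇒nCk≡0 {1} {suc (suc k)} (s≤s (s≤s z≤n))) ⟩
  suc (suc k) * 0                   ≡⟨ *-zeroʳ (suc (suc k)) ⟩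
  0                                 ≡⟨ cong (1 *_) (k>n⇒nCk≡0 {0} {suc k} (s≤s z≤n)) ⟨
  1 * (0 C suc k)                   ∎
  where open ≡-Reasoning
[1+k]*[1+n]C[1+k]≡[1+n]*nCk (suc n) zero =
  trans (*-identityˡ _) (trans (nC1≡n (suc (suc n))) (sym (*-identityʳ _)))
[1+k]*[1+n]C[1+k]≡[1+n]*nCk (suc n) (suc k) = begin
  suc (suc k) * (suc (suc n) C suc (suc k))
    ≡⟨ cong (suc (suc k) *_) (nCk+nC[k+1]≡[n+1]C[k+1] (suc n) (suc k)) ⟨
  suc (suc k) * (p + suc n C suc (suc k))
    ≡⟨ *-distribˡ-+ (suc (suc k)) p _ ⟩
  (p + suc k * p) + suc (suc k) * (suc n C suc (suc k))
    ≡⟨ cong₂ (λ x y → p + x + y) ([1+k]*[1+n]C[1+k]≡[1+n]*nCk n k) ([1+k]*[1+n]C[1+k]≡[1+n]*nCk n (suc k)) ⟩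
  p + suc n * (n C k) + suc n * (n C suc k)
    ≡⟨ +-assoc p _ _ ⟩
  p + (suc n * (n C k) + suc n * (n C suc k))
    ≡⟨ cong (p +_) (*-distribˡ-+ (suc n) (n C k) (n C suc k)) ⟨
  p + suc n * (n C k + n C suc k)
    ≡⟨ cong (λ x → p + suc n * x) (nCk+nC[k+1]≡[n+1]C[k+1] n k) ⟩
  suc (suc n) * p ∎
  where
  open ≡-Reasoning
  p = suc n C suc k

-- This is (k+1)C(n,k+1) = (n-k)C(n,k) with (k+1)C(n,k) added to both sides, so that no truncated
-- difference appears.
[1+k]*nC[1+k]+[1+k]*nCk≡[1+n]*nCk : ∀ n k → suc k * (n C suc k) + suc k * (n C k) ≡ suc n * (n C k)
[1+k]*nC[1+k]+[1+k]*nCk≡[1+n]*nCk n k = begin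
  suc k * (n C suc k) + suc k * (n C k)  ≡⟨ *-distribˡ-+ (suc k) (n C suc k) (n C k) ⟨
  suc k * (n C suc k + n C k)            ≡⟨ cong (suc k *_) (+-comm (n C suc k) (n C k)) ⟩
  suc k * (n C k + n C suc k)            ≡⟨ cong (suc k *_) (nCk+nC[k+1]≡[n+1]C[k+1] n k) ⟩
  suc k * (suc n C suc k)                ≡⟨ [1+k]*[1+n]C[1+k]≡[1+n]*nCk n k ⟩
  suc n * (n C k)                        ∎
  where open ≡-Reasoning

[m+n]Cn≡[m+n]Cm : ∀ m n → (m + n) C n ≡ (m + n) C m
[m+n]Cn≡[m+n]Cm m n = trans (nCk≡nC[n∸k] (m≤n+m n m)) (cong ((m + n) C_) (m+n∸n≡m m n))

nCk>0 : ∀ {n k} → k ≤ n → 0 < n C k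
nCk>0 {n} {zero} _ = s≤s z≤n
nCk>0 {suc n} {suc k} (s≤s k≤n) = subst (0 <_) (nCk+nC[k+1]≡[n+1]C[k+1] n k)
  (≤-trans (nCk>0 k≤n) (m≤m+n _ _))

k!*nCk≤n^k : ∀ n k → k ! * (n C k) ≤ n ^ k
k!*nCk≤n^k n zero = ≤-refl
k!*nCk≤n^k zero (suc k) = ≤-reflexive (trans (cong (suc k ! *_) (k>n⇒nCk≡0 {0} {suc k} (s≤s z≤n))) (*-zeroʳ (suc k !)))
k!*nCk≤n^k (suc n) (suc k) = begin
  suc k ! * (suc n C suc k)         ≡⟨ lem (suc k) (k !) (suc n C suc k) ⟩
  k ! * (suc k * (suc n C suc k))   ≡⟨ cong (k ! *_) ([1+k]*[1+n]C[1+k]≡[1+n]*nCk n k) ⟩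
  k ! * (suc n * (n C k))           ≡⟨ lem′ (k !) (suc n) (n C k) ⟩
  suc n * (k ! * (n C k))           ≤⟨ *-monoʳ-≤ (suc n) (k!*nCk≤n^k n k) ⟩
  suc n * n ^ k                     ≤⟨ *-monoʳ-≤ (suc n) (^-monoˡ-≤ k (n≤1+n n)) ⟩
  suc n * suc n ^ k                 ∎
  where
  open ≤-Reasoning
  lem : ∀ a b c → a * b * c ≡ b * (a * c)
  lem = solve-∀
  lem′ : ∀ a b c → a * (b * c) ≡ b * (a * c)
  lem′ = solve-∀

-- Σ_{l ≤ L} C(i,l) m^{L-l}
binomialSum : ℕ → ℕ → ℕ → ℕ
binomialSum m i zero    = 1
binomialSum m i (suc L) = m * binomialSum m i L + i C suc L

binomialSum-pascal : ∀ m i L → binomialSum m (suc i) (suc L) ≡ binomialSum m i (suc L) + binomialSum m i L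
binomialSum-pascal m i zero = begin
  m * 1 + suc i C 1      ≡⟨ cong (m * 1 +_) (nC1≡n (suc i)) ⟩
  m * 1 + suc i          ≡⟨ lem m i ⟩
  m * 1 + i + 1          ≡⟨ cong (λ x → m * 1 + x + 1) (nC1≡n i) ⟨
  m * 1 + i C 1 + 1      ∎
  where
  open ≡-Reasoning
  lem : ∀ m i → m * 1 + suc i ≡ m * 1 + i + 1
  lem = solve-∀
binomialSum-pascal m i (suc L) = begin
  m * binomialSum m (suc i) (suc L) + suc i C suc (suc L)
    ≡⟨ cong₂ (λ x y → m * x + y) (binomialSum-pascal m i L) (sym (nCk+nC[k+1]≡[n+1]C[k+1] i (suc L))) ⟩
  m * (binomialSum m i (suc L) + binomialSum m i L) + (i C suc L + i C suc (suc L))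
    ≡⟨ lem m _ _ _ _ ⟩
  m * binomialSum m i (suc L) + i C suc (suc L) + (m * binomialSum m i L + i C suc L) ∎
  where
  open ≡-Reasoning
  lem : ∀ m a b c d → m * (a + b) + (c + d) ≡ m * a + d + (m * b + c)
  lem = solve-∀

binomialSum-full : ∀ m i → binomialSum m i i ≡ suc m ^ i
binomialSum-full m zero = refl
binomialSum-full m (suc i) = begin
  binomialSum m (suc i) (suc i)                           ≡⟨ binomialSum-pascal m i i ⟩
  m * binomialSum m i i + i C suc i + binomialSum m i i   ≡⟨ cong (λ x → m * binomialSum m i i + x + binomialSum m i i) (k>n⇒nCk≡0 (n<1+n i)) ⟩
  m * binomialSum m i i + 0 + binomialSum m i i           ≡⟨ lem m (binomialSum m i i) ⟩
  suc m * binomialSum m i i                               ≡⟨ cong (suc m *_) (binomialSum-full m i) ⟩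
  suc m * suc m ^ i                                       ∎
  where
  open ≡-Reasoning
  lem : ∀ m x → m * x + 0 + x ≡ suc m * x
  lem = solve-∀

-- m! Σ_{i ≤ m} 1/i!
eSum! : ℕ → ℕ
eSum! zero    = 1
eSum! (suc m) = suc m * eSum! m + 1

-- The row stays at `m` while the truncation `L` grows; this is why truncated sums are considered at
-- all. The new term C(m,L+1) is at most m^(L+1)/(L+1)!, matching the term 1/(L+1)! gained by the
-- series of e.
L!*binomialSum≤ : ∀ m L → L ! * binomialSum m m L ≤ eSum! L * m ^ L
L!*binomialSum≤ m zero = ≤-refl
L!*binomialSum≤ m (suc L) = begin
  suc L ! * (m * binomialSum m m L + m C suc L)
    ≡⟨ lem (suc L) (L !) m (binomialSum m m L) (m C suc L) ⟩
  suc L * m * (L ! * binomialSum m m L) + suc L ! * (m C suc L)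
    ≤⟨ +-mono-≤ (*-monoʳ-≤ (suc L * m) (L!*binomialSum≤ m L)) (k!*nCk≤n^k m (suc L)) ⟩
  suc L * m * (eSum! L * m ^ L) + m ^ suc L
    ≡⟨ lem′ (suc L) m (eSum! L) (m ^ L) ⟩
  (suc L * eSum! L + 1) * (m * m ^ L) ∎
  where
  open ≤-Reasoning
  lem : ∀ l f m s c → l * f * (m * s + c) ≡ l * m * (f * s) + l * f * c
  lem = solve-∀
  lem′ : ∀ l m e p → l * m * (e * p) + m * p ≡ (l * e + 1) * (m * p)
  lem′ = solve-∀

-- (1 + 1/m)^m ≤ Σ_{i ≤ m} 1/i!
m!*[1+m]^m≤eSum!*m^m : ∀ m → m ! * suc m ^ m ≤ eSum! m * m ^ m
m!*[1+m]^m≤eSum!*m^m m = subst (λ x → m ! * x ≤ eSum! m * m ^ m) (binomialSum-full m m) (L!*binomialSum≤ m m)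

-- The loss at one level and its decay

levelBound : ℕ → ℕ → ℕ
levelBound t j = ((j + t) C j) * suc j ^ j

levelMass : ℕ → ℕ → ℕ → ℕ → ℕ
levelMass t r N j = levelBound t j * ((N ∸ j) C (r ∸ j))

-- The quotient of consecutive masses is (j+t+1) · (1 + 1/(j+1))^(j+1) · (r-j)/(N-j). The first
-- factor is at most t + r, the last at most r/N, and `e-bound` at j + 1 controls the middle one.
-- All denominators are cleared by the common factor `m * suc ν * N`, where `suc ν` is N - j.
levelMass-halves : ∀ {t r N} .{{_ : NonZero N}} →
  (∀ m → 2 * suc m ^ m * (t + r) * r ≤ m ^ m * N) → r ≤ N →
  ∀ {j} → j < r → 2 * levelMass t r N (suc j) ≤ levelMass t r N j
levelMass-halves {t} {r} {N} e-bound r≤N {j} j<r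
  = *-cancelʳ-≤ _ _ (m * suc ν * N) {{m*n≢0 (m * suc ν) N {{m*n≢0 m (suc ν)}}}} (begin
    2 * ((c′ * e′) * b′) * (m * suc ν * N)
      ≡⟨ solve₁ c′ e′ b′ m (suc ν) N ⟩
    (m * c′) * (suc ν * b′) * (2 * e′ * N)
      ≡⟨ cong₂ (λ x y → x * y * (2 * e′ * N)) ([1+k]*[1+n]C[1+k]≡[1+n]*nCk (j + t) j) (sym ([1+k]*[1+n]C[1+k]≡[1+n]*nCk ν ρ)) ⟩
    (suc (j + t) * c) * (suc ρ * (suc ν C suc ρ)) * (2 * e′ * N)
      ≡⟨ cong₂ (λ x y → (suc (j + t) * c) * (suc ρ * (x C y)) * (2 * e′ * N)) N∸j r∸j ⟨
    (suc (j + t) * c) * (suc ρ * b) * (2 * e′ * N)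
      ≡⟨ solve₂ (suc (j + t)) c (suc ρ) b e′ N ⟩
    (c * b * (2 * e′)) * (suc (j + t) * (suc ρ * N))
      ≤⟨ *-monoʳ-≤ (c * b * (2 * e′)) (*-mono-≤ m+t≤k ρN≤rν) ⟩
    (c * b * (2 * e′)) * ((t + r) * (r * suc ν))
      ≡⟨ solve₃ c b e′ (t + r) r (suc ν) ⟩
    (c * b * suc ν) * (2 * e′ * (t + r) * r)
      ≤⟨ *-monoʳ-≤ (c * b * suc ν) (e-bound m) ⟩
    (c * b * suc ν) * (m * m ^ j * N)
      ≡⟨ solve₄ c b (suc ν) m (m ^ j) N ⟩
    c * m ^ j * b * (m * suc ν * N) ∎)
  where
  open ≤-Reasoning
  m = suc j
  ρ = r ∸ m
  ν = N ∸ m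
  e′ = suc m ^ m
  c  = (j + t) C j
  c′ = (m + t) C m
  b  = (N ∸ j) C (r ∸ j)
  b′ = ν C ρ
  r∸j : r ∸ j ≡ suc ρ
  r∸j = +-∸-assoc 1 j<r
  N∸j : N ∸ j ≡ suc ν
  N∸j = +-∸-assoc 1 (≤-trans j<r r≤N)
  m+t≤k : suc (j + t) ≤ t + r
  m+t≤k = ≤-trans (+-monoˡ-≤ t j<r) (≤-reflexive (+-comm r t))
  ρN≤rν : suc ρ * N ≤ r * suc ν
  ρN≤rν = subst₂ (λ x y → x * N ≤ r * y) r∸j N∸j (begin
    (r ∸ j) * N       ≡⟨ *-distribʳ-∸ N r j ⟩
    r * N ∸ j * N     ≤⟨ ∸-monoʳ-≤ (r * N) (*-monoʳ-≤ j r≤N) ⟩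
    r * N ∸ j * r     ≡⟨ cong (r * N ∸_) (*-comm j r) ⟩
    r * N ∸ r * j     ≡⟨ *-distribˡ-∸ r N j ⟨
    r * (N ∸ j)       ∎)
  solve₁ : ∀ c e b m ν N → 2 * ((c * e) * b) * (m * ν * N) ≡ (m * c) * (ν * b) * (2 * e * N)
  solve₁ = solve-∀
  solve₂ : ∀ a c ρ b e N → (a * c) * (ρ * b) * (2 * e * N) ≡ (c * b * (2 * e)) * (a * (ρ * N))
  solve₂ = solve-∀
  solve₃ : ∀ c b e k r ν → (c * b * (2 * e)) * (k * (r * ν)) ≡ (c * b * ν) * (2 * e * k * r)
  solve₃ = solve-∀
  solve₄ : ∀ c b ν m p N → (c * b * ν) * (m * p * N) ≡ c * p * b * (m * ν * N)
  solve₄ = solve-∀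

module _ {t s M : ℕ}
  (2≤t : 2 ≤ t)
  (N≥18[t+2]r : 18 * (t + 2) * (2 + s) ≤ 3 + M)
  (N≥2ekr : ∀ m → 2 * suc m ^ m * (t + (2 + s)) * (2 + s) ≤ m ^ m * (3 + M)) where

  private
    r N D : ℕ
    r = 2 + s
    N = 3 + M
    D = suc M C suc s

    2kr≤N : 2 * (t + r) * r ≤ N
    -- At `m` = 0 both powers in the hypothesis equal 1.
    2kr≤N = ≤-trans (N≥2ekr 0) (≤-reflexive (*-identityˡ N))

    r*r≤N : r * r ≤ N
    r*r≤N = ≤-trans (*-monoˡ-≤ r (≤-trans (m≤n+m r t) (m≤m+n (t + r) _))) 2kr≤N

    r+r≤N : r + r ≤ N
    r+r≤N = ≤-trans (≤-reflexive (cong (r +_) (sym (+-identityʳ r)))) (≤-trans (*-monoˡ-≤ r {2} (s≤s (s≤s (z≤n {s})))) r*r≤N)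

    s≤M : s ≤ M
    s≤M = +-cancelˡ-≤ 3 s M (≤-trans (s≤s (s≤s (≤-trans (n≤1+n (suc s)) (m≤n+m (2 + s) s)))) r+r≤N)

    module Offset {a b} (a≤b : a ≤ b) where
      o = b ∸ a
      eq : b ≡ a + o
      eq = sym (m+[n∸m]≡n a≤b)

  0<D : 0 < D
  0<D = nCk>0 (s≤s s≤M)

  -- Since C(N-2,r-2) = D(r-1)/(N-r), the claim amounts to N(r-1) ≤ r(N-r), that is, r² ≤ N. Here
  -- `suc o` is N - r.
  N*[N-2]C[r-2]≤r*[N-2]C[r-1] : N * (suc M C s) ≤ r * D
  N*[N-2]C[r-2]≤r*[N-2]C[r-1] = *-cancelˡ-≤ (suc o) (begin
    suc o * (N * x)              ≡⟨ solve₁ (suc o) N x ⟩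
    N * (suc o * x)              ≡⟨ cong (N *_) absorb ⟨
    N * (suc s * D)              ≡⟨ solve₂ N (suc s) D ⟩
    (N * suc s) * D              ≤⟨ *-monoˡ-≤ D N*[1+s]≤ ⟩
    (suc o * r) * D              ≡⟨ *-assoc (suc o) r D ⟩
    suc o * (r * D)              ∎)
    where
    open ≤-Reasoning
    open Offset s≤M
    x = suc M C s
    solve₁ : ∀ a b c → a * (b * c) ≡ b * (a * c)
    solve₁ = solve-∀
    solve₂ : ∀ a b c → a * (b * c) ≡ (a * b) * c
    solve₂ = solve-∀
    solve₃ : ∀ s o x → suc (suc (s + o)) * x ≡ suc o * x + suc s * x
    solve₃ = solve-∀
    absorb : suc s * D ≡ suc o * x
    absorb = +-cancelʳ-≡ (suc s * x) _ _ (trans ([1+k]*nC[1+k]+[1+k]*nCk≡[1+n]*nCk (suc M) s)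
      (trans (cong (λ m → suc (suc m) * x) eq) (solve₃ s o x)))
    N*[1+s]≤ : N * suc s ≤ suc o * r
    N*[1+s]≤ = +-cancelʳ-≤ N _ _ (begin
      N * suc s + N        ≡⟨ solve₅ N s ⟩
      N * r                ≡⟨ cong (λ m → (3 + m) * r) eq ⟩
      (3 + (s + o)) * r    ≡⟨ solve₆ s o ⟩
      suc o * r + r * r    ≤⟨ +-monoʳ-≤ (suc o * r) r*r≤N ⟩
      suc o * r + N        ∎)
      where
      solve₅ : ∀ N s → N * suc s + N ≡ N * (2 + s)
      solve₅ = solve-∀
      solve₆ : ∀ s o → (3 + (s + o)) * (2 + s) ≡ suc o * (2 + s) + (2 + s) * (2 + s)
      solve₆ = solve-∀

  -- By absorption C(N-3,r-2) = D(r-1)/(N-2), so 2r ≤ N suffices.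
  N*[N-3]C[r-2]≤r*[N-2]C[r-1] : N * (M C s) ≤ r * D
  N*[N-3]C[r-2]≤r*[N-2]C[r-1] = *-cancelˡ-≤ (suc M) (begin
    suc M * (N * x)              ≡⟨ solve₁ (suc M) N x ⟩
    N * (suc M * x)              ≡⟨ cong (N *_) ([1+k]*[1+n]C[1+k]≡[1+n]*nCk M s) ⟨
    N * (suc s * D)              ≡⟨ solve₂ N (suc s) D ⟩
    (N * suc s) * D              ≤⟨ *-monoˡ-≤ D N*[1+s]≤ ⟩
    (suc M * r) * D              ≡⟨ *-assoc (suc M) r D ⟩
    suc M * (r * D)              ∎)
    where
    open ≤-Reasoning
    x = M C s
    solve₁ : ∀ a b c → a * (b * c) ≡ b * (a * c)
    solve₁ = solve-∀
    solve₂ : ∀ a b c → a * (b * c) ≡ (a * b) * c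
    solve₂ = solve-∀
    N*[1+s]≤ : N * suc s ≤ suc M * r
    N*[1+s]≤ = +-cancelʳ-≤ N _ _ (begin
      N * suc s + N          ≡⟨ solve₃ M s ⟩
      suc M * r + (r + r)    ≤⟨ +-monoʳ-≤ (suc M * r) r+r≤N ⟩
      suc M * r + N          ∎)
      where
      solve₃ : ∀ M s → (3 + M) * suc s + (3 + M) ≡ suc M * (2 + s) + ((2 + s) + (2 + s))
      solve₃ = solve-∀

  -- This makes a `t`-set with a point outside Z no better a centre for 𝓐(Z) than one inside Z. By
  -- Pascal's rule it reduces to t C(N-3,r-2) ≤ 2 C(N-3,r-1), hence to t(r-1) ≤ 2(N-r-1); `o` is N -
  -- r - 1.
  t*[N-2]C[r-1]≤[t+2]*[N-3]C[r-1] : t * D ≤ (t + 2) * (M C suc s)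
  t*[N-2]C[r-1]≤[t+2]*[N-3]C[r-1] = begin
    t * D                        ≡⟨ cong (t *_) (nCk+nC[k+1]≡[n+1]C[k+1] M s) ⟨
    t * (x + y)                  ≡⟨ *-distribˡ-+ t x y ⟩
    t * x + t * y                ≤⟨ +-monoˡ-≤ (t * y) tx≤2y ⟩
    2 * y + t * y                ≡⟨ solve₁ t y ⟩
    (t + 2) * y                  ∎
    where
    open ≤-Reasoning
    open Offset s≤M
    x = M C s
    y = M C suc s
    solve₁ : ∀ t y → 2 * y + t * y ≡ (t + 2) * y
    solve₁ = solve-∀
    solve₂ : ∀ s o x → suc (s + o) * x ≡ o * x + suc s * x
    solve₂ = solve-∀
    absorb : suc s * y ≡ o * x
    absorb = +-cancelʳ-≡ (suc s * x) _ _ (trans ([1+k]*nC[1+k]+[1+k]*nCk≡[1+n]*nCk M s)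
      (trans (cong (λ m → suc m * x) eq) (solve₂ s o x)))
    t[1+s]≤2o : suc s * t ≤ 2 * o
    t[1+s]≤2o = +-cancelʳ-≤ (2 * (s + 3)) _ _ (begin
      -- The added polynomial is exactly the difference to 36(t+2)(s+2).
      suc s * t + 2 * (s + 3)              ≤⟨ m≤m+n _ (35 * (s * t) + 70 * s + 71 * t + 138) ⟩
      suc s * t + 2 * (s + 3) + (35 * (s * t) + 70 * s + 71 * t + 138) ≡⟨ solve₃ s t ⟩
      2 * (18 * (t + 2) * (2 + s))         ≤⟨ *-monoʳ-≤ 2 N≥18[t+2]r ⟩
      2 * (3 + M)                          ≡⟨ cong (λ m → 2 * (3 + m)) eq ⟩
      2 * (3 + (s + o))                    ≡⟨ solve₄ s o ⟩
      2 * o + 2 * (s + 3)                  ∎)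
      where
      solve₃ : ∀ s t → suc s * t + 2 * (s + 3) + (35 * (s * t) + 70 * s + 71 * t + 138) ≡ 2 * (18 * (t + 2) * (2 + s))
      solve₃ = solve-∀
      solve₄ : ∀ s o → 2 * (3 + (s + o)) ≡ 2 * o + 2 * (s + 3)
      solve₄ = solve-∀
    solve₅ : ∀ a b c → a * (b * c) ≡ (a * b) * c
    solve₅ = solve-∀
    solve₆ : ∀ a b c → a * (b * c) ≡ b * (a * c)
    solve₆ = solve-∀
    tx≤2y : t * x ≤ 2 * y
    tx≤2y = *-cancelˡ-≤ (suc s) (begin
      suc s * (t * x)   ≡⟨ solve₅ (suc s) t x ⟩
      suc s * t * x     ≤⟨ *-monoˡ-≤ x t[1+s]≤2o ⟩
      2 * o * x         ≡⟨ *-assoc 2 o x ⟩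
      2 * (o * x)       ≡⟨ cong (2 *_) absorb ⟨
      2 * (suc s * y)   ≡⟨ solve₆ 2 (suc s) y ⟩
      suc s * (2 * y)   ∎)

  -- Everything is multiplied by 36N. Of the 36 shares of tD, the peeling uses 27 and the sets
  -- meeting G outside Z use 8; the remaining one gives strictness.
  2*levelMass₂+tk[N-3]C[r-2]<t*[N-2]C[r-1] : 2 * levelMass t r N 2 + t * ((t + r) * (M C s)) < t * D
  2*levelMass₂+tk[N-3]C[r-2]<t*[N-2]C[r-1] = *-cancelˡ-< (36 * N) _ _ (begin-strict
    36 * N * (2 * levelMass t r N 2 + t * ((t + r) * x))
      ≡⟨ solve₁ N ((2 + t) C 2) y t (t + r) x ⟩
    36 * (9 * (2 * ((2 + t) C 2)) * (N * y)) + 36 * (t * (t + r) * (N * x))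
      ≡⟨ cong (λ z → 36 * (9 * z * (N * y)) + 36 * (t * (t + r) * (N * x))) 2*[2+t]C2 ⟩
    36 * (9 * ((2 + t) * (1 + t)) * (N * y)) + 36 * (t * (t + r) * (N * x))
      ≤⟨ +-mono-≤ (*-monoʳ-≤ 36 (*-monoʳ-≤ (9 * ((2 + t) * (1 + t))) N*[N-2]C[r-2]≤r*[N-2]C[r-1]))
                  (*-monoʳ-≤ 36 (*-monoʳ-≤ (t * (t + r)) N*[N-3]C[r-2]≤r*[N-2]C[r-1])) ⟩
    36 * (9 * ((2 + t) * (1 + t)) * (r * D)) + 36 * (t * (t + r) * (r * D))
      ≡⟨ solve₂ t r D ⟩
    (18 * (1 + t) * (18 * (t + 2) * r) + 2 * t * (18 * (t + r) * r)) * D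
      -- `N≥2ekr 2` is the hypothesis with (3/2)^2 in place of e, namely 18kr ≤ 4N.
      ≤⟨ *-monoˡ-≤ D (+-mono-≤ (*-monoʳ-≤ (18 * (1 + t)) N≥18[t+2]r) (*-monoʳ-≤ (2 * t) (N≥2ekr 2))) ⟩
    (18 * (1 + t) * N + 2 * t * (4 * N)) * D
      ≤⟨ *-monoˡ-≤ D (+-monoˡ-≤ (2 * t * (4 * N)) (*-monoˡ-≤ N 18[1+t]≤27t)) ⟩
    (27 * t * N + 2 * t * (4 * N)) * D
      ≡⟨ solve₃ t N D ⟩
    35 * (N * (t * D))
      <⟨ *-monoˡ-< (N * (t * D)) {{>-nonZero (*-mono-≤ (s≤s (z≤n {2 + M})) (*-mono-≤ (≤-trans (s≤s z≤n) 2≤t) 0<D))}} (n<1+n 35) ⟩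
    36 * (N * (t * D))
      ≡⟨ *-assoc 36 N (t * D) ⟨
    36 * N * (t * D) ∎)
    where
    open ≤-Reasoning
    x = M C s
    y = suc M C s
    2*[2+t]C2 : 2 * ((2 + t) C 2) ≡ (2 + t) * (1 + t)
    2*[2+t]C2 = trans ([1+k]*[1+n]C[1+k]≡[1+n]*nCk (suc t) 1) (cong ((2 + t) *_) (nC1≡n (suc t)))
    18[1+t]≤27t : 18 * (1 + t) ≤ 27 * t
    18[1+t]≤27t = begin
      18 * (1 + t)     ≡⟨ solve₄ t ⟩
      9 * 2 + 18 * t   ≤⟨ +-monoˡ-≤ (18 * t) (*-monoʳ-≤ 9 2≤t) ⟩
      9 * t + 18 * t   ≡⟨ solve₅ t ⟩
      27 * t           ∎
      where
      solve₄ : ∀ t → 18 * (1 + t) ≡ 9 * 2 + 18 * t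
      solve₄ = solve-∀
      solve₅ : ∀ t → 9 * t + 18 * t ≡ 27 * t
      solve₅ = solve-∀
    solve₁ : ∀ N c y t k x → 36 * N * (2 * (c * 9 * y) + t * (k * x)) ≡ 36 * (9 * (2 * c) * (N * y)) + 36 * (t * k * (N * x))
    solve₁ = solve-∀
    solve₂ : ∀ t r D → 36 * (9 * ((2 + t) * (1 + t)) * (r * D)) + 36 * (t * (t + r) * (r * D)) ≡ (18 * (1 + t) * (18 * (t + 2) * r) + 2 * t * (18 * (t + r) * r)) * D
    solve₂ = solve-∀
    solve₃ : ∀ t N D → (27 * t * N + 2 * t * (4 * N)) * D ≡ 35 * (N * (t * D))
    solve₃ = solve-∀

-- The rational hypothesis

toℚᵘ-fromℕ : ∀ a → toℚᵘ (fromℕ a) ≃ mkℚᵘ (ℤ.+ a) 0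
toℚᵘ-fromℕ a = ℚ.toℚᵘ-fromℚᵘ (mkℚᵘ (ℤ.+ a) 0)

fromℕ-+ : ∀ a b → fromℕ (a + b) ≡ fromℕ a ℚ.+ fromℕ b
fromℕ-+ a b = ℚ.toℚᵘ-injective (begin
  toℚᵘ (fromℕ (a + b))                      ≈⟨ toℚᵘ-fromℕ (a + b) ⟩
  mkℚᵘ (ℤ.+ (a + b)) 0                        ≈⟨ *≡* (cong (ℤ._* ℤ.+ 1) (cong₂ ℤ._+_ (sym (ℤ.*-identityʳ (ℤ.+ a))) (sym (ℤ.*-identityʳ (ℤ.+ b))))) ⟩
  mkℚᵘ (ℤ.+ a) 0 ℚᵘ.+ mkℚᵘ (ℤ.+ b) 0            ≈⟨ ℚᵘ.+-cong (toℚᵘ-fromℕ a) (toℚᵘ-fromℕ b) ⟨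
  toℚᵘ (fromℕ a) ℚᵘ.+ toℚᵘ (fromℕ b)        ≈⟨ ℚ.toℚᵘ-homo-+ (fromℕ a) (fromℕ b) ⟨
  toℚᵘ (fromℕ a ℚ.+ fromℕ b)                ∎)
  where open ℚᵘ.≃-Reasoning

fromℕ-* : ∀ a b → fromℕ (a * b) ≡ fromℕ a ℚ.* fromℕ b
fromℕ-* a b = ℚ.toℚᵘ-injective (begin
  toℚᵘ (fromℕ (a * b))                      ≈⟨ toℚᵘ-fromℕ (a * b) ⟩
  mkℚᵘ (ℤ.+ (a * b)) 0                        ≈⟨ *≡* (cong (ℤ._* ℤ.+ 1) (ℤ.pos-* a b)) ⟩
  mkℚᵘ (ℤ.+ a) 0 ℚᵘ.* mkℚᵘ (ℤ.+ b) 0            ≈⟨ ℚᵘ.*-cong (toℚᵘ-fromℕ a) (toℚᵘ-fromℕ b) ⟨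
  toℚᵘ (fromℕ a) ℚᵘ.* toℚᵘ (fromℕ b)        ≈⟨ ℚ.toℚᵘ-homo-* (fromℕ a) (fromℕ b) ⟨
  toℚᵘ (fromℕ a ℚ.* fromℕ b)                ∎)
  where open ℚᵘ.≃-Reasoning

fromℕ-cancel-≤ : ∀ {a b} → fromℕ a ℚ.≤ fromℕ b → a ≤ b
fromℕ-cancel-≤ {a} {b} a≤b with ℚᵘ.≤-respʳ-≃ (toℚᵘ-fromℕ b) (ℚᵘ.≤-respˡ-≃ (toℚᵘ-fromℕ a) (ℚ.toℚᵘ-mono-≤ a≤b))
... | *≤* le = ℤ.drop‿+≤+ (subst₂ ℤ._≤_ (ℤ.*-identityʳ (ℤ.+ a)) (ℤ.*-identityʳ (ℤ.+ b)) le)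

fromℕ-nonNeg : ∀ a → ℚ.NonNegative (fromℕ a)
fromℕ-nonNeg a = ℚ.normalize-nonNeg a 1

1/d*d≡1 : ∀ d .{{_ : NonZero d}} → (ℤ.+ 1 ℚ./ d) ℚ.* fromℕ d ≡ 1ℚ
1/d*d≡1 (suc d) = ℚ.toℚᵘ-injective (begin
  toℚᵘ ((ℤ.+ 1 ℚ./ suc d) ℚ.* fromℕ (suc d))           ≈⟨ ℚ.toℚᵘ-homo-* (ℤ.+ 1 ℚ./ suc d) (fromℕ (suc d)) ⟩
  toℚᵘ (ℤ.+ 1 ℚ./ suc d) ℚᵘ.* toℚᵘ (fromℕ (suc d))     ≈⟨ ℚᵘ.*-cong (ℚ.toℚᵘ-fromℚᵘ (mkℚᵘ (ℤ.+ 1) d)) (toℚᵘ-fromℕ (suc d)) ⟩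
  mkℚᵘ (ℤ.+ 1) d ℚᵘ.* mkℚᵘ (ℤ.+ suc d) 0                 ≈⟨ *≡* (cong ℤ.+_ (lem d)) ⟩
  ℚᵘ.1ℚᵘ                                             ∎)
  where
  open ℚᵘ.≃-Reasoning
  lem : ∀ d → suc (d + 0) * 1 ≡ suc (d * 1 + 0)
  lem = solve-∀

eSum*m!≡eSum! : ∀ m → eSum m ℚ.* fromℕ (m !) ≡ fromℕ (eSum! m)
eSum*m!≡eSum! zero = refl
eSum*m!≡eSum! (suc m) = begin
  (eSum m ℚ.+ 1/ suc m !) ℚ.* fromℕ (suc m !)
    ≡⟨ ℚ.*-distribʳ-+ (fromℕ (suc m !)) (eSum m) (1/ suc m !) ⟩
  eSum m ℚ.* fromℕ (suc m !) ℚ.+ 1/ suc m ! ℚ.* fromℕ (suc m !)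
    ≡⟨ cong₂ ℚ._+_ (cong (eSum m ℚ.*_) (fromℕ-* (suc m) (m !))) (1/d*d≡1 (suc m !) {{suc m !≢0}}) ⟩
  eSum m ℚ.* (fromℕ (suc m) ℚ.* fromℕ (m !)) ℚ.+ 1ℚ
    ≡⟨ cong (ℚ._+ 1ℚ) (solve 3 (λ a b c → a :* (b :* c) := b :* (a :* c)) refl (eSum m) (fromℕ (suc m)) (fromℕ (m !))) ⟩
  fromℕ (suc m) ℚ.* (eSum m ℚ.* fromℕ (m !)) ℚ.+ 1ℚ
    ≡⟨ cong (λ x → fromℕ (suc m) ℚ.* x ℚ.+ 1ℚ) (eSum*m!≡eSum! m) ⟩
  fromℕ (suc m) ℚ.* fromℕ (eSum! m) ℚ.+ fromℕ 1
    ≡⟨ cong (ℚ._+ 1ℚ) (fromℕ-* (suc m) (eSum! m)) ⟨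
  fromℕ (suc m * eSum! m) ℚ.+ fromℕ 1
    ≡⟨ fromℕ-+ (suc m * eSum! m) 1 ⟨
  fromℕ (suc m * eSum! m + 1) ∎
  where
  open ≡-Reasoning
  open +-*-Solver

module _ {n t r : ℕ} (n≥bound : fromℕ n ≥[e] bound (t + r) t) where

  private
    k : ℕ
    k = t + r

    k-t≡r : fromℕ k ℚ.- fromℕ t ≡ fromℕ r
    k-t≡r = trans (cong (ℚ._- fromℕ t) (fromℕ-+ t r))
      (solve 2 (λ a b → a :+ b :- a := b) refl (fromℕ t) (fromℕ r))
      where open +-*-Solver

    factor : ℕ → ℚ
    factor m = fromℕ (18 * (t + 2)) ℚ.⊔ (fromℕ 2 ℚ.* eSum m ℚ.* fromℕ k)

    larger : ∀ m {y} → y ℚ.≤ factor m →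
             fromℕ t ℚ.+ fromℕ r ℚ.* y ℚ.≤ fromℕ n
    larger m {y} y≤ = ℚ.≤-trans
      (ℚ.+-monoʳ-≤ (fromℕ t) (ℚ.*-monoˡ-≤-nonNeg (fromℕ r) {{fromℕ-nonNeg r}} y≤))
      (subst (λ x → fromℕ t ℚ.+ x ℚ.* factor m ℚ.≤ fromℕ n) k-t≡r (n≥bound m))

  bound⇒t+18[t+2]r≤n : t + 18 * (t + 2) * r ≤ n
  bound⇒t+18[t+2]r≤n = fromℕ-cancel-≤ (subst (ℚ._≤ fromℕ n) eq (larger 0 (ℚ.p≤p⊔q _ _)))
    where
    eq : fromℕ t ℚ.+ fromℕ r ℚ.* fromℕ (18 * (t + 2)) ≡ fromℕ (t + 18 * (t + 2) * r)
    eq = sym (trans (fromℕ-+ t _) (cong (fromℕ t ℚ.+_) (trans (fromℕ-* (18 * (t + 2)) r) (ℚ.*-comm _ (fromℕ r)))))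

  -- Multiplying by m! clears the denominators of the partial sum, so the rational hypothesis can be
  -- read off in the natural numbers.
  bound⇒m!t+2eSum!kr≤m!n : ∀ m → m ! * t + 2 * eSum! m * k * r ≤ m ! * n
  bound⇒m!t+2eSum!kr≤m!n m = fromℕ-cancel-≤ (subst₂ ℚ._≤_ eq (sym (fromℕ-* (m !) n))
    (ℚ.*-monoˡ-≤-nonNeg (fromℕ (m !)) {{fromℕ-nonNeg (m !)}} (larger m (ℚ.p≤q⊔p (fromℕ (18 * (t + 2))) _))))
    where
    open ≡-Reasoning
    open +-*-Solver
    eq : fromℕ (m !) ℚ.* (fromℕ t ℚ.+ fromℕ r ℚ.* (fromℕ 2 ℚ.* eSum m ℚ.* fromℕ k)) ≡
         fromℕ (m ! * t + 2 * eSum! m * k * r)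
    eq = begin
      fromℕ (m !) ℚ.* (fromℕ t ℚ.+ fromℕ r ℚ.* (fromℕ 2 ℚ.* eSum m ℚ.* fromℕ k))
        ≡⟨ solve 6 (λ f t r d e k → f :* (t :+ r :* (d :* e :* k)) := f :* t :+ d :* (e :* f) :* k :* r)
             refl (fromℕ (m !)) (fromℕ t) (fromℕ r) (fromℕ 2) (eSum m) (fromℕ k) ⟩
      fromℕ (m !) ℚ.* fromℕ t ℚ.+ fromℕ 2 ℚ.* (eSum m ℚ.* fromℕ (m !)) ℚ.* fromℕ k ℚ.* fromℕ r
        ≡⟨ cong (λ x → fromℕ (m !) ℚ.* fromℕ t ℚ.+ fromℕ 2 ℚ.* x ℚ.* fromℕ k ℚ.* fromℕ r) (eSum*m!≡eSum! m) ⟩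
      fromℕ (m !) ℚ.* fromℕ t ℚ.+ fromℕ 2 ℚ.* fromℕ (eSum! m) ℚ.* fromℕ k ℚ.* fromℕ r
        ≡⟨ cong₂ ℚ._+_ (fromℕ-* (m !) t) (trans (fromℕ-* (2 * eSum! m * k) r) (cong (ℚ._* fromℕ r)
             (trans (fromℕ-* (2 * eSum! m) k) (cong (ℚ._* fromℕ k) (fromℕ-* 2 (eSum! m)))))) ⟨
      fromℕ (m ! * t) ℚ.+ fromℕ (2 * eSum! m * k * r)
        ≡⟨ fromℕ-+ (m ! * t) _ ⟨
      fromℕ (m ! * t + 2 * eSum! m * k * r) ∎

  -- 2(1 + 1/m)^m k r ≤ n - t
  bound⇒2[1+m]^mkr≤m^m[n∸t] : ∀ m → 2 * suc m ^ m * k * r ≤ m ^ m * (n ∸ t)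
  bound⇒2[1+m]^mkr≤m^m[n∸t] m = *-cancelˡ-≤ (m !) {{m !≢0}} (begin
    m ! * (2 * suc m ^ m * k * r)           ≡⟨ lem (m !) (suc m ^ m) k r ⟩
    (m ! * suc m ^ m) * (2 * k * r)         ≤⟨ *-monoˡ-≤ (2 * k * r) (m!*[1+m]^m≤eSum!*m^m m) ⟩
    (eSum! m * m ^ m) * (2 * k * r)         ≡⟨ lem′ (eSum! m) (m ^ m) k r ⟩
    m ^ m * (2 * eSum! m * k * r)           ≤⟨ *-monoʳ-≤ (m ^ m) (m+n≤o⇒n≤o∸m (bound⇒m!t+2eSum!kr≤m!n m)) ⟩
    m ^ m * (m ! * n ∸ m ! * t)             ≡⟨ cong (m ^ m *_) (*-distribˡ-∸ (m !) n t) ⟨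
    m ^ m * (m ! * (n ∸ t))                 ≡⟨ lem″ (m ^ m) (m !) (n ∸ t) ⟩
    m ! * (m ^ m * (n ∸ t))                 ∎)
    where
    open ≤-Reasoning
    m+n≤o⇒n≤o∸m : ∀ {m n o} → m + n ≤ o → n ≤ o ∸ m
    m+n≤o⇒n≤o∸m {m} {n} le = m+n≤o⇒m≤o∸n n (≤-trans (≤-reflexive (+-comm n m)) le)
    lem : ∀ f p k r → f * (2 * p * k * r) ≡ (f * p) * (2 * k * r)
    lem = solve-∀
    lem′ : ∀ e p k r → (e * p) * (2 * k * r) ≡ p * (2 * e * k * r)
    lem′ = solve-∀
    lem″ : ∀ a b c → a * (b * c) ≡ b * (a * c)
    lem″ = solve-∀

-- Peeling

∈star⁺ : {S A : Subset n} {𝓕 : Family n} → A ∈ᶠ 𝓕 → S ⊆ A → A ∈ᶠ star S 𝓕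
∈star⁺ {S = S} {A} A∈𝓕 S⊆A = T-∧⁺ A∈𝓕 (fromWitness {a? = S ⊆? A} S⊆A)

∈star⁻ : {S A : Subset n} {𝓕 : Family n} → A ∈ᶠ star S 𝓕 → A ∈ᶠ 𝓕 × S ⊆ A
∈star⁻ {S = S} {A} A∈ = proj₁ (T-∧⁻ A∈) , toWitness {a? = S ⊆? A} (proj₂ (T-∧⁻ A∈))

find : (𝓕 : Family n) → Dec (∃[ A ] A ∈ᶠ 𝓕)
find 𝓕 = anySubset? (λ A → T? (𝓕 A))

Bounded : ℕ → Family n → Set
Bounded q 𝓣 = ∀ A → A ∈ᶠ 𝓣 → ∣ A ∣ ≤ q

-- Testing the removal of single points is enough: a smaller subset of `W` lies in some `W - x` and
-- meets the same `V` in no more points.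
Irreducible : ℕ → ℕ → Family n → Set
Irreducible t q 𝓣 = ∀ W x → W ∈ᶠ 𝓣 → ∣ W ∣ ≡ q → x ∈ W → ∃[ V ] (V ∈ᶠ 𝓣 × ∣ (W - x) ∩ V ∣ < t)

-- The link between 𝓕 and the shrinking family. Replacing a set by a subset keeps every covered set
-- covered, so members of 𝓕 are lost only when sets are discarded.
Covers : Family n → Subset n → Set
Covers 𝓣 A = ∃[ V ] (V ∈ᶠ 𝓣 × V ⊆ A)

covers? : (𝓣 : Family n) (A : Subset n) → Dec (Covers 𝓣 A)
covers? 𝓣 A = anySubset? (λ V → T? (𝓣 V) ×-dec V ⊆? A)

level : ℕ → Family n → Family n
level q 𝓣 A = ⌊ T? (𝓣 A) ×-dec ∣ A ∣ ≟ q ⌋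

∈level⁺ : {q : ℕ} {𝓣 : Family n} {A : Subset n} → A ∈ᶠ 𝓣 → ∣ A ∣ ≡ q → A ∈ᶠ level q 𝓣
∈level⁺ {q = q} {𝓣} {A} A∈ ∣A∣ = fromWitness {a? = T? (𝓣 A) ×-dec ∣ A ∣ ≟ q} (A∈ , ∣A∣)

∈level⁻ : {q : ℕ} {𝓣 : Family n} {A : Subset n} → A ∈ᶠ level q 𝓣 → A ∈ᶠ 𝓣 × ∣ A ∣ ≡ q
∈level⁻ {q = q} {𝓣} {A} A∈ = toWitness {a? = T? (𝓣 A) ×-dec ∣ A ∣ ≟ q} A∈

replace : Subset n → Subset n → Family n → Family n
replace W W′ 𝓣 A = ⌊ (T? (𝓣 A) ×-dec ¬? (A ≟ˢ W)) ⊎-dec (A ≟ˢ W′) ⌋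

∈replace⁺ : {W W′ A : Subset n} {𝓣 : Family n} → (A ∈ᶠ 𝓣 × A ≢ W) ⊎ A ≡ W′ → A ∈ᶠ replace W W′ 𝓣
∈replace⁺ {W = W} {W′} {A} {𝓣} h = fromWitness {a? = (T? (𝓣 A) ×-dec ¬? (A ≟ˢ W)) ⊎-dec (A ≟ˢ W′)} h

∈replace⁻ : {W W′ A : Subset n} {𝓣 : Family n} → A ∈ᶠ replace W W′ 𝓣 → (A ∈ᶠ 𝓣 × A ≢ W) ⊎ A ≡ W′
∈replace⁻ {W = W} {W′} {A} {𝓣} h = toWitness {a? = (T? (𝓣 A) ×-dec ¬? (A ≟ˢ W)) ⊎-dec (A ≟ˢ W′)} h

uncovered : Family n → Family n → Family n
uncovered 𝓣 𝓕 A = ⌊ T? (𝓕 A) ×-dec ¬? (covers? 𝓣 A) ⌋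

∈uncovered⁺ : {𝓣 𝓕 : Family n} {A : Subset n} → A ∈ᶠ 𝓕 → ¬ Covers 𝓣 A → A ∈ᶠ uncovered 𝓣 𝓕
∈uncovered⁺ {𝓣 = 𝓣} {𝓕} {A} A∈ ∅ = fromWitness {a? = T? (𝓕 A) ×-dec ¬? (covers? 𝓣 A)} (A∈ , ∅)

∈uncovered⁻ : {𝓣 𝓕 : Family n} {A : Subset n} → A ∈ᶠ uncovered 𝓣 𝓕 → A ∈ᶠ 𝓕 × ¬ Covers 𝓣 A
∈uncovered⁻ {𝓣 = 𝓣} {𝓕} {A} A∈ = toWitness {a? = T? (𝓕 A) ×-dec ¬? (covers? 𝓣 A)} A∈

∩-monoˡ-∣∣ : {p q r : Subset n} → p ⊆ q → ∣ p ∩ r ∣ ≤ ∣ q ∩ r ∣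
∩-monoˡ-∣∣ {p = p} {q} {r} p⊆q = p⊆q⇒∣p∣≤∣q∣ (⊆-∩ (p⊆q ∘ p∩q⊆p p r) (p∩q⊆q p r))

-- A failure of irreducibility is a pair `W`, `x` for which `W - x` still meets every member in `t`
-- points, so `W` can be replaced by `W - x`. Each replacement lowers the number of members of size
-- `q`, which `fuel` bounds.
reduce : {t q : ℕ} → t < q → ∀ fuel (𝓣 : Family n) → card (level q 𝓣) ≤ fuel →
  Intersecting t 𝓣 → Bounded q 𝓣 →
  ∃[ 𝓢 ] (Intersecting t 𝓢 × Bounded q 𝓢 × Irreducible t q 𝓢 × (∀ A → Covers 𝓣 A → Covers 𝓢 A))
reduce {n} {t} {q} t<q fuel 𝓣 le int bnd
  with anySubset? (λ W → T? (𝓣 W) ×-dec ∣ W ∣ ≟ q ×-dec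
         Fin.any? (λ x → x ∈? W ×-dec ¬? (anySubset? λ V → T? (𝓣 V) ×-dec ∣ (W - x) ∩ V ∣ <? t)))
... | no irr = 𝓣 , int , bnd , irreducible , λ _ → id
  where
  irreducible : Irreducible t q 𝓣
  irreducible W x W∈ ∣W∣ x∈W = decidable-stable (anySubset? λ V → T? (𝓣 V) ×-dec ∣ (W - x) ∩ V ∣ <? t)
    λ ∄V → irr (W , W∈ , ∣W∣ , x , x∈W , ∄V)
... | yes (W , W∈ , ∣W∣ , x , x∈W , ∄V) = shrink fuel le
  where
  W′ : Subset n
  W′ = W - x
  𝓣′ : Family n
  𝓣′ = replace W W′ 𝓣
  1+∣W′∣≡q : suc ∣ W′ ∣ ≡ q
  1+∣W′∣≡q = trans (suc∣p-x∣≡∣p∣ x∈W) ∣W∣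
  W′-int : ∀ V → V ∈ᶠ 𝓣 → t ≤ ∣ W′ ∩ V ∣
  W′-int V V∈ = ≮⇒≥ λ lt → ∄V (V , V∈ , lt)
  int′ : Intersecting t 𝓣′
  int′ A B A∈ B∈ with ∈replace⁻ {𝓣 = 𝓣} A∈ | ∈replace⁻ {𝓣 = 𝓣} B∈
  ... | inj₁ (A∈ , _) | inj₁ (B∈ , _) = int A B A∈ B∈
  ... | inj₁ (A∈ , _) | inj₂ refl = subst (λ p → t ≤ ∣ p ∣) (∩-comm W′ A) (W′-int A A∈)
  ... | inj₂ refl | inj₁ (B∈ , _) = W′-int B B∈
  -- The new set must also meet itself in `t` points; its size is q - 1, and `t < q`.
  ... | inj₂ refl | inj₂ refl = subst (λ p → t ≤ ∣ p ∣) (sym (∩-idem W′)) (s≤s⁻¹ (≤-trans t<q (≤-reflexive (sym 1+∣W′∣≡q))))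
  bnd′ : Bounded q 𝓣′
  bnd′ A A∈ with ∈replace⁻ {𝓣 = 𝓣} A∈
  ... | inj₁ (A∈ , _) = bnd A A∈
  ... | inj₂ refl = ≤-trans (n≤1+n _) (≤-reflexive 1+∣W′∣≡q)
  W≢W′ : W ≢ W′
  W≢W′ eq = 1+n≢n (trans 1+∣W′∣≡q (trans (sym ∣W∣) (cong ∣_∣ eq)))
  fewer : card (level q 𝓣′) < card (level q 𝓣)
  fewer = card-mono-< sub W (∈level⁺ {𝓣 = 𝓣} W∈ ∣W∣) λ W∈′ →
    [ (λ h → proj₂ h refl) , W≢W′ ]′ (∈replace⁻ {𝓣 = 𝓣} (proj₁ (∈level⁻ {q = q} {𝓣′} W∈′)))
    where
    sub : level q 𝓣′ ⊆ᶠ level q 𝓣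
    sub A A∈ with ∈level⁻ {q = q} {𝓣′} A∈
    ... | A∈ , ∣A∣ with ∈replace⁻ {𝓣 = 𝓣} A∈
    ... | inj₁ (A∈ , _) = ∈level⁺ {𝓣 = 𝓣} A∈ ∣A∣
    ... | inj₂ refl = ⊥-elim (1+n≢n (trans 1+∣W′∣≡q (sym ∣A∣)))
  covers′ : ∀ A → Covers 𝓣 A → Covers 𝓣′ A
  covers′ A (V , V∈ , V⊆A) with V ≟ˢ W
  ... | yes refl = W′ , ∈replace⁺ {𝓣 = 𝓣} (inj₂ refl) , V⊆A ∘ p-x⊆p W x
  ... | no V≢W   = V , ∈replace⁺ {𝓣 = 𝓣} (inj₁ (V∈ , V≢W)) , V⊆A
  shrink : ∀ fuel → card (level q 𝓣) ≤ fuel →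
    ∃[ 𝓢 ] (Intersecting t 𝓢 × Bounded q 𝓢 × Irreducible t q 𝓢 × (∀ A → Covers 𝓣 A → Covers 𝓢 A))
  shrink zero le = ⊥-elim (<⇒≱ fewer (≤-trans le z≤n))
  shrink (suc fuel) le
    with 𝓢 , int″ , bnd″ , irr , cov ← reduce t<q fuel 𝓣′ (s≤s⁻¹ (≤-trans fewer le)) int′ bnd′
    = 𝓢 , int″ , bnd″ , irr , λ A → cov A ∘ covers′ A

card-supersets : {W : Subset n} {𝓕 : Family n} {k a b : ℕ} → Uniform k 𝓕 → ∣ W ∣ + a ≡ k → ∣ W ∣ + b ≡ n →
                 card (star W 𝓕) ≤ b C a
card-supersets {W = W} {𝓕} {k} uni eqₖ eqₙ = subst (card (star W 𝓕) ≤_) (card-traces id eqₖ eqₙ)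
  (card-mono λ A A∈ → let A∈𝓕 , W⊆A = ∈star⁻ {𝓕 = 𝓕} A∈ in
    ∈traces⁺ {k = k} (uni A A∈𝓕) (trans (∩-comm A W) (p⊆q⇒p∩q≡p W⊆A)))

-- Counting the irreducible members of size t + j by branching

module LevelBound {t j : ℕ} {𝓣 : Family n}
  (int : Intersecting t 𝓣) (bnd : Bounded (t + j) 𝓣) (irr : Irreducible t (t + j) 𝓣) where

  private
    𝓦 : Family n
    𝓦 = level (t + j) 𝓣

  -- Every member of 𝓦 above Y meets V ∖ Y in at least t - |Y ∩ V| points.
  extension-bound : (Y V : Subset n) → V ∈ᶠ 𝓣 → (i B : ℕ) → 1 ≤ i → ∣ Y ∩ V ∣ + i ≤ t →
    (∀ x → x ∉ Y → card (star (Y ∪ ⁅ x ⁆) 𝓦) ≤ B) → i * card (star Y 𝓦) ≤ (j + i) * B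
  -- Double counting yields d c ≤ (j+d)B for the true deficiency d = t - |Y ∩ V|. As (j+d)/d
  -- decreases in d, it may be replaced by any smaller `i` ≥ 1.
  extension-bound Y V V∈ i B 1≤i le up = *-cancelˡ-≤ d {{>-nonZero (≤-trans 1≤i i≤d)}} (begin
    d * (i * c)          ≡⟨ swap d i c ⟩
    i * (d * c)          ≤⟨ *-monoʳ-≤ i dc≤ ⟩
    i * ((j + d) * B)    ≡⟨ expand i j d B ⟩
    (i * j + i * d) * B  ≤⟨ *-monoˡ-≤ B (+-monoˡ-≤ (i * d) (*-monoˡ-≤ j i≤d)) ⟩
    (d * j + i * d) * B  ≡⟨ collect i j d B ⟩
    d * ((j + i) * B)    ∎)
    where
    open ≤-Reasoning
    c = card (star Y 𝓦)
    d = t ∸ ∣ Y ∩ V ∣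
    i≤d : i ≤ d
    i≤d = m+n≤o⇒m≤o∸n i (≤-trans (≤-reflexive (+-comm i _)) le)
    d+∣Y∩V∣≡t : d + ∣ Y ∩ V ∣ ≡ t
    d+∣Y∩V∣≡t = m∸n+n≡m (m+n≤o⇒m≤o ∣ Y ∩ V ∣ le)
    swap : ∀ a b c → a * (b * c) ≡ b * (a * c)
    swap = solve-∀
    expand : ∀ i j d B → i * ((j + d) * B) ≡ (i * j + i * d) * B
    expand = solve-∀
    collect : ∀ i j d B → (d * j + i * d) * B ≡ d * ((j + i) * B)
    collect = solve-∀
    ∣V─Y∣≤j+d : ∣ V ─ Y ∣ ≤ j + d
    ∣V─Y∣≤j+d = +-cancelʳ-≤ ∣ Y ∩ V ∣ _ _ (begin
      ∣ V ─ Y ∣ + ∣ Y ∩ V ∣    ≡⟨ cong (λ p → ∣ V ─ Y ∣ + ∣ p ∣) (∩-comm Y V) ⟩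
      ∣ V ─ Y ∣ + ∣ V ∩ Y ∣    ≡⟨ ∣p─q∣+∣p∩q∣≡∣p∣ V Y ⟩
      ∣ V ∣                    ≤⟨ bnd V V∈ ⟩
      t + j                    ≡⟨ +-comm t j ⟩
      j + t                    ≡⟨ cong (j +_) d+∣Y∩V∣≡t ⟨
      j + (d + ∣ Y ∩ V ∣)      ≡⟨ +-assoc j d _ ⟨
      j + d + ∣ Y ∩ V ∣        ∎)
    meet : ∀ A → A ∈ᶠ 𝓣 → d ≤ ∣ V ∩ A ─ Y ∣
    meet A A∈ = +-cancelʳ-≤ ∣ Y ∩ V ∣ _ _ (begin
      d + ∣ Y ∩ V ∣                        ≡⟨ d+∣Y∩V∣≡t ⟩
      t                                    ≤⟨ int V A V∈ A∈ ⟩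
      ∣ V ∩ A ∣                            ≡⟨ ∣p─q∣+∣p∩q∣≡∣p∣ (V ∩ A) Y ⟨
      ∣ V ∩ A ─ Y ∣ + ∣ (V ∩ A) ∩ Y ∣      ≤⟨ +-monoʳ-≤ ∣ V ∩ A ─ Y ∣ (∩-monoˡ-∣∣ (p∩q⊆p V A)) ⟩
      ∣ V ∩ A ─ Y ∣ + ∣ V ∩ Y ∣            ≡⟨ cong (λ p → ∣ V ∩ A ─ Y ∣ + ∣ p ∣) (∩-comm V Y) ⟩
      ∣ V ∩ A ─ Y ∣ + ∣ Y ∩ V ∣            ∎)
    dc≤ : d * c ≤ (j + d) * B
    dc≤ = ≤-trans
      (double-count-points (V ─ Y) (λ x → star (Y ∪ ⁅ x ⁆) 𝓦) (star Y 𝓦) d B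
        (λ x x∈ → up x (x∈p─q⇒x∉q V Y x∈))
        λ A A∈ → let A∈𝓦 , Y⊆A = ∈star⁻ {𝓕 = 𝓦} A∈ in
          V ∩ A ─ Y , meet A (proj₁ (∈level⁻ {q = t + j} {𝓣} A∈𝓦)) , λ x∈ →
            let x∈V∩A = p─q⊆p (V ∩ A) Y x∈ in
            x∈p∧x∉q⇒x∈p─q (p∩q⊆p V A x∈V∩A) (x∈p─q⇒x∉q (V ∩ A) Y x∈) ,
            ∈star⁺ {𝓕 = 𝓦} A∈𝓦 (∪-⊆ Y⊆A (⁅x⁆⊆ (p∩q⊆q V A x∈V∩A))))
      (*-monoˡ-≤ B ∣V─Y∣≤j+d)

  -- A set `Y` with `t` or more points may meet every member well, so irreducibility has to supply
  -- the branching set: for `y` in `W` outside `Y`, some `V` meets `W - y`, and with it `Y`, in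
  -- fewer than `t` points. The deficiency is then at least 1, and each step costs a factor j + 1.
  above-large : ∀ m Y → ∣ Y ∣ + m ≡ t + j → card (star Y 𝓦) ≤ suc j ^ m
  above-large zero Y eq = ≤-trans
    (card-supersets {k = t + j} (λ A A∈ → proj₂ (∈level⁻ {q = t + j} {𝓣} A∈)) eq (m+[n∸m]≡n (∣p∣≤n Y)))
    ≤-refl
  above-large (suc m) Y eq with find (star Y 𝓦)
  ... | no ∅ = ≤-trans (≤-reflexive (card-empty λ A A∈ → ∅ (A , A∈))) z≤n
  ... | yes (W , W∈) with ∈star⁻ {𝓕 = 𝓦} W∈
  ... | W∈𝓦 , Y⊆W with ∈level⁻ {q = t + j} {𝓣} W∈𝓦 | ⊆-or-witness W Y
  ... | _ , ∣W∣ | inj₁ W⊆Y = ⊥-elim (<⇒≱ (m<m+n ∣ Y ∣ (s≤s z≤n))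
    (≤-trans (≤-reflexive (trans eq (sym ∣W∣))) (p⊆q⇒∣p∣≤∣q∣ W⊆Y)))
  ... | W∈𝓣 , ∣W∣ | inj₂ (y , y∈W , y∉Y) with irr W y W∈𝓣 ∣W∣ y∈W
  ... | V , V∈ , lt = begin
    card (star Y 𝓦)         ≡⟨ *-identityˡ _ ⟨
    1 * card (star Y 𝓦)     ≤⟨ extension-bound Y V V∈ 1 (suc j ^ m) ≤-refl
                                 (≤-trans (≤-reflexive (+-comm _ 1)) (≤-trans (s≤s (∩-monoˡ-∣∣ Y⊆W-y)) lt))
                                 (λ x x∉Y → above-large m (Y ∪ ⁅ x ⁆)
                                   (trans (cong (_+ m) (∣p∪⁅x⁆∣≡suc∣p∣ x∉Y)) (trans (sym (+-suc ∣ Y ∣ m)) eq))) ⟩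
    (j + 1) * suc j ^ m     ≡⟨ cong (_* suc j ^ m) (+-comm j 1) ⟩
    suc j * suc j ^ m       ∎
    where
    open ≤-Reasoning
    Y⊆W-y : Y ⊆ W - y
    Y⊆W-y x∈Y = x∈p∧x≢y⇒x∈p-y (Y⊆W x∈Y) λ { refl → y∉Y x∈Y }

  -- While |Y| = t - i, any member can serve as `V`, with deficiency at least i. The step costs
  -- (j+i)/i instead of j + 1, and the product of these factors over i ≤ t is C(j+t,t).
  above-small : ∀ i Y → ∣ Y ∣ + i ≡ t → card (star Y 𝓦) ≤ ((j + i) C i) * suc j ^ j
  above-small zero Y eq = ≤-trans
    (above-large j Y (cong (_+ j) (trans (sym (+-identityʳ _)) eq))) (≤-reflexive (sym (*-identityˡ _)))
  above-small (suc i) Y eq with find (star Y 𝓦)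
  ... | no ∅ = ≤-trans (≤-reflexive (card-empty λ A A∈ → ∅ (A , A∈))) z≤n
  ... | yes (V , V∈) = *-cancelˡ-≤ (suc i) (begin
    suc i * card (star Y 𝓦)
      ≤⟨ extension-bound Y V (proj₁ (∈level⁻ {q = t + j} {𝓣} (proj₁ (∈star⁻ {𝓕 = 𝓦} V∈)))) (suc i) _ (s≤s z≤n)
           (≤-trans (+-monoˡ-≤ (suc i) (∣p∩q∣≤∣p∣ Y V)) (≤-reflexive eq))
           (λ x x∉Y → above-small i (Y ∪ ⁅ x ⁆)
             (trans (cong (_+ i) (∣p∪⁅x⁆∣≡suc∣p∣ x∉Y)) (trans (sym (+-suc ∣ Y ∣ i)) eq))) ⟩
    (j + suc i) * (((j + i) C i) * suc j ^ j)
      ≡⟨ *-assoc (j + suc i) ((j + i) C i) (suc j ^ j) ⟨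
    (j + suc i) * ((j + i) C i) * suc j ^ j
      ≡⟨ cong (λ x → x * ((j + i) C i) * suc j ^ j) (+-suc j i) ⟩
    suc (j + i) * ((j + i) C i) * suc j ^ j
      ≡⟨ cong (_* suc j ^ j) ([1+k]*[1+n]C[1+k]≡[1+n]*nCk (j + i) i) ⟨
    suc i * (suc (j + i) C suc i) * suc j ^ j
      ≡⟨ cong (λ x → suc i * (x C suc i) * suc j ^ j) (+-suc j i) ⟨
    suc i * ((j + suc i) C suc i) * suc j ^ j
      ≡⟨ *-assoc (suc i) ((j + suc i) C suc i) (suc j ^ j) ⟩
    suc i * (((j + suc i) C suc i) * suc j ^ j) ∎)
    where open ≤-Reasoning

  card-level : card 𝓦 ≤ levelBound t j
  card-level = begin
    card 𝓦                        ≤⟨ card-mono (λ A A∈ → ∈star⁺ {𝓕 = 𝓦} A∈ (⊆-min A)) ⟩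
    card (star ⊥ 𝓦)               ≤⟨ above-small t ⊥ (cong (_+ t) (∣⊥∣≡0 n)) ⟩
    ((j + t) C t) * suc j ^ j     ≡⟨ cong (_* suc j ^ j) ([m+n]Cn≡[m+n]Cm j t) ⟩
    levelBound t j                ∎
    where open ≤-Reasoning

-- Descending through the levels

module Peeling {t r N : ℕ} (n≡t+N : n ≡ t + N) (r≤N : r ≤ N)
  (halves : ∀ {j} → j < r → 2 * levelMass t r N (suc j) ≤ levelMass t r N j)
  {𝓕 : Family n} (uni : Uniform (t + r) 𝓕) (int𝓕 : Intersecting t 𝓕) where

  Kernel : ℕ → ℕ → Set
  Kernel q c = ∃[ 𝓣 ] (Intersecting t 𝓣 × Bounded q 𝓣 × card (uncovered 𝓣 𝓕) ≤ c)

  -- `reduce` loses nothing. Discarding the irreducible sets afterwards loses only members of 𝓕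
  -- above one of them, and each has at most C(N-j-1,r-j-1) supersets in 𝓕.
  peel-level : ∀ {j c} → suc j ≤ r → Kernel (t + suc j) c → Kernel (t + j) (c + levelMass t r N (suc j))
  peel-level {j} {c} j<r (𝓣 , int , bnd , le)
    with 𝓢 , intˢ , bndˢ , irrˢ , cov ← reduce (m<m+n t (s≤s z≤n)) (card (level (t + suc j) 𝓣)) 𝓣 ≤-refl int bnd
    = 𝓢′ , int′ , bnd′ , le′
    where
    q = t + suc j
    𝓢′ : Family n
    𝓢′ A = ⌊ T? (𝓢 A) ×-dec ¬? (∣ A ∣ ≟ q) ⌋
    ∈𝓢′⁻ : ∀ {A} → A ∈ᶠ 𝓢′ → A ∈ᶠ 𝓢 × ∣ A ∣ ≢ q
    ∈𝓢′⁻ {A} A∈ = toWitness {a? = T? (𝓢 A) ×-dec ¬? (∣ A ∣ ≟ q)} A∈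
    int′ : Intersecting t 𝓢′
    int′ A B A∈ B∈ = intˢ A B (proj₁ (∈𝓢′⁻ A∈)) (proj₁ (∈𝓢′⁻ B∈))
    bnd′ : Bounded (t + j) 𝓢′
    bnd′ A A∈ = let A∈𝓢 , ≢q = ∈𝓢′⁻ A∈ in
      s≤s⁻¹ (≤-trans (≤∧≢⇒< (bndˢ A A∈𝓢) ≢q) (≤-reflexive (+-suc t j)))
    supersets : Family n
    supersets A = ⌊ T? (𝓕 A) ×-dec covers? (level q 𝓢) A ⌋
    split : ∀ A → A ∈ᶠ uncovered 𝓢′ 𝓕 → A ∈ᶠ uncovered 𝓣 𝓕 ⊎ A ∈ᶠ supersets
    split A A∈ with ∈uncovered⁻ {𝓣 = 𝓢′} {𝓕} A∈ | toSum (covers? 𝓣 A)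
    ... | A∈𝓕 , ¬cov | inj₂ ∅ = inj₁ (∈uncovered⁺ {𝓣 = 𝓣} {𝓕} A∈𝓕 ∅)
    ... | A∈𝓕 , ¬cov | inj₁ c with cov A c
    ... | V , V∈ , V⊆A with ∣ V ∣ ≟ q
    ... | yes ∣V∣ = inj₂ (fromWitness {a? = T? (𝓕 A) ×-dec covers? (level q 𝓢) A}
                      (A∈𝓕 , V , ∈level⁺ {𝓣 = 𝓢} V∈ ∣V∣ , V⊆A))
    ... | no  ∣V∣ = ⊥-elim (¬cov (V , fromWitness {a? = T? (𝓢 V) ×-dec ¬? (∣ V ∣ ≟ q)} (V∈ , ∣V∣) , V⊆A))
    card-supersets′ : card supersets ≤ levelMass t r N (suc j)
    card-supersets′ = ≤-trans
      (union-bound-family (level q 𝓢) (λ W → star W 𝓕) supersets ((N ∸ suc j) C (r ∸ suc j))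
        (λ W W∈ → let ∣W∣ = proj₂ (∈level⁻ {q = q} {𝓢} W∈) in
          card-supersets uni
            (trans (cong (_+ (r ∸ suc j)) ∣W∣) (trans (+-assoc t (suc j) _) (cong (t +_) (m+[n∸m]≡n j<r))))
            (trans (cong (_+ (N ∸ suc j)) ∣W∣) (trans (+-assoc t (suc j) _)
              (trans (cong (t +_) (m+[n∸m]≡n (≤-trans j<r r≤N))) (sym n≡t+N)))))
        λ A A∈ → let A∈𝓕 , W , W∈ , W⊆A = toWitness {a? = T? (𝓕 A) ×-dec covers? (level q 𝓢) A} A∈ in
          W , W∈ , ∈star⁺ {𝓕 = 𝓕} A∈𝓕 W⊆A)
      (*-monoˡ-≤ _ (LevelBound.card-level intˢ bndˢ irrˢ))
    le′ : card (uncovered 𝓢′ 𝓕) ≤ c + levelMass t r N (suc j)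
    le′ = ≤-trans (card-cover (uncovered 𝓢′ 𝓕) (uncovered 𝓣 𝓕) supersets split) (+-mono-≤ le card-supersets′)

  Kernel-mono : ∀ {q c d} → c ≤ d → Kernel q c → Kernel q d
  Kernel-mono c≤d (𝓣 , int , bnd , le) = 𝓣 , int , bnd , ≤-trans le c≤d

  j+[1+d]≡r⇒j<r : ∀ {j d} → j + suc d ≡ r → j < r
  j+[1+d]≡r⇒j<r {j} eq = ≤-trans (m<m+n j (s≤s z≤n)) (≤-reflexive eq)

  a+a≡2*a : ∀ a → a + a ≡ 2 * a
  a+a≡2*a a = cong (a +_) (sym (+-identityʳ a))

  -- The invariant replaces the summation of a geometric series: the loss so far and the loss at
  -- level j + 1 are both at most `levelMass t r N (suc j)`, and twice that is at most the mass at
  -- j.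
  peel-to : ∀ d j → j + d ≡ r → Kernel (t + j) (levelMass t r N j)
  peel-to zero j eq = 𝓕 , int𝓕 ,
    (λ A A∈ → ≤-reflexive (trans (uni A A∈) (cong (t +_) (trans (sym eq) (+-identityʳ j))))) ,
    ≤-trans (≤-reflexive (card-empty λ A A∈ → let A∈𝓕 , ∅ = ∈uncovered⁻ {𝓣 = 𝓕} {𝓕} A∈ in ∅ (A , A∈𝓕 , id))) z≤n
  peel-to (suc d) j eq = Kernel-mono
    (≤-trans (≤-reflexive (a+a≡2*a (levelMass t r N (suc j)))) (halves (j+[1+d]≡r⇒j<r eq)))
    (peel-level (j+[1+d]≡r⇒j<r eq) (peel-to d (suc j) (trans (sym (+-suc j d)) eq)))

  -- The last level is not absorbed into levelMass t r N 1, which would be too large.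
  kernel : 2 ≤ r → Kernel (t + 1) (2 * levelMass t r N 2)
  kernel 2≤r = Kernel-mono (≤-reflexive (a+a≡2*a (levelMass t r N 2)))
    (peel-level 2≤r (peel-to (r ∸ 2) 2 (m+[n∸m]≡n 2≤r)))

-- The bottom of the peeling

∣p∣≤∣p∩q∣⇒p⊆q : {p q : Subset n} → ∣ p ∣ ≤ ∣ p ∩ q ∣ → p ⊆ q
∣p∣≤∣p∩q∣⇒p⊆q {p = p} {q} le = subst (_⊆ q) (⊆∧∣∣≥⇒≡ (p∩q⊆p p q) le) (p∩q⊆q p q)

-- Three (t+1)-sets pairwise meeting in at least t points, without a common t-subset,
-- span only t+2 points; a further such set cannot leave their union.
module Triangle {t : ℕ} {𝓣 : Family n} (int : Intersecting t 𝓣) (size : ∀ V → V ∈ᶠ 𝓣 → ∣ V ∣ ≡ t + 1)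
  {T₀ T₁ T₂ : Subset n} (T₀∈ : T₀ ∈ᶠ 𝓣) (T₁∈ : T₁ ∈ᶠ 𝓣) (T₂∈ : T₂ ∈ᶠ 𝓣) (∣T₀∩T₁∣≡t : ∣ T₀ ∩ T₁ ∣ ≡ t)
  {x : Fin n} (x∈T₀ : x ∈ T₀) (x∈T₁ : x ∈ T₁) (x∉T₂ : x ∉ T₂) where

  private
    Z : Subset n
    Z = T₀ ∪ T₁

    ∣V-y∣≡t : ∀ {V y} → V ∈ᶠ 𝓣 → y ∈ V → ∣ V - y ∣ ≡ t
    ∣V-y∣≡t {V} V∈ y∈V = suc-injective (trans (suc∣p-x∣≡∣p∣ y∈V) (trans (size V V∈) (+-comm t 1)))

    -- `V ∩ U` lies in `V - y`, which has exactly `t` points, so the two coincide.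
    almost-⊆ : ∀ {V U y} → V ∈ᶠ 𝓣 → U ∈ᶠ 𝓣 → y ∈ V → y ∉ U → V - y ⊆ U
    almost-⊆ {V} {U} {y} V∈ U∈ y∈V y∉U = subst (_⊆ U)
      (⊆∧∣∣≥⇒≡ V∩U⊆ (≤-trans (≤-reflexive (∣V-y∣≡t V∈ y∈V)) (int V U V∈ U∈))) (p∩q⊆q V U)
      where
      V∩U⊆ : V ∩ U ⊆ V - y
      V∩U⊆ z∈ = x∈p∧x≢y⇒x∈p-y (p∩q⊆p V U z∈) λ { refl → y∉U (p∩q⊆q V U z∈) }

    Z-x⊆T₂ : Z - x ⊆ T₂
    Z-x⊆T₂ y∈ with x∈p∪q⁻ T₀ T₁ (p-x⊆p Z x y∈)
    ... | inj₁ y∈T₀ = almost-⊆ T₀∈ T₂∈ x∈T₀ x∉T₂ (x∈p∧x≢y⇒x∈p-y y∈T₀ (x∈p-y⇒x≢y {p = Z} y∈))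
    ... | inj₂ y∈T₁ = almost-⊆ T₁∈ T₂∈ x∈T₁ x∉T₂ (x∈p∧x≢y⇒x∈p-y y∈T₁ (x∈p-y⇒x≢y {p = Z} y∈))

  ∣T₀∪T₁∣≡t+2 : ∣ T₀ ∪ T₁ ∣ ≡ t + 2
  ∣T₀∪T₁∣≡t+2 = +-cancelʳ-≡ t _ _ (begin
    ∣ Z ∣ + t                ≡⟨ cong (∣ Z ∣ +_) ∣T₀∩T₁∣≡t ⟨
    ∣ Z ∣ + ∣ T₀ ∩ T₁ ∣      ≡⟨ ∣p∪q∣+∣p∩q∣≡∣p∣+∣q∣ T₀ T₁ ⟩
    ∣ T₀ ∣ + ∣ T₁ ∣          ≡⟨ cong₂ _+_ (size T₀ T₀∈) (size T₁ T₁∈) ⟩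
    (t + 1) + (t + 1)        ≡⟨ rearrange t ⟩
    t + 2 + t                ∎)
    where
    open ≡-Reasoning
    rearrange : ∀ t → (t + 1) + (t + 1) ≡ t + 2 + t
    rearrange = solve-∀

  private
    -- In fact `T₂` equals `Z - x`: it contains that set, and both have t + 1 points.
    T₂⊆Z : T₂ ⊆ Z
    T₂⊆Z = subst (_⊆ Z) (⊆∧∣∣≥⇒≡ Z-x⊆T₂ (≤-reflexive (suc-injective (begin
      suc ∣ T₂ ∣       ≡⟨ cong suc (size T₂ T₂∈) ⟩
      suc (t + 1)      ≡⟨ +-suc t 1 ⟨
      t + 2            ≡⟨ ∣T₀∪T₁∣≡t+2 ⟨
      ∣ Z ∣            ≡⟨ suc∣p-x∣≡∣p∣ (p⊆p∪q T₁ x∈T₀) ⟨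
      suc ∣ Z - x ∣    ∎)))) (p-x⊆p Z x)
      where open ≡-Reasoning

  -- If `y` in `V` were outside `Z`, then `V - y` would lie in all three sets, hence in `T₀ ∩ T₁`
  -- without `x`. That leaves fewer than `t` points for a set of size `t`.
  confined : ∀ V → V ∈ᶠ 𝓣 → V ⊆ T₀ ∪ T₁
  confined V V∈ with ⊆-or-witness V Z
  ... | inj₁ V⊆Z = V⊆Z
  ... | inj₂ (y , y∈V , y∉Z) = ⊥-elim (<-irrefl (trans (∣V-y∣≡t V∈ y∈V) (sym ∣T₀∩T₁∣≡t)) (p⊂q⇒∣p∣<∣q∣ V-y⊂S))
    where
    within : ∀ {U} → U ∈ᶠ 𝓣 → U ⊆ Z → V - y ⊆ U
    within U∈ U⊆Z = almost-⊆ V∈ U∈ y∈V (y∉Z ∘ U⊆Z)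
    V-y⊂S : V - y ⊂ T₀ ∩ T₁
    V-y⊂S = ⊆-∩ (within T₀∈ (p⊆p∪q T₁)) (within T₁∈ (q⊆p∪q T₀ T₁)) ,
      x , x∈p∩q⁺ (x∈T₀ , x∈T₁) , x∉T₂ ∘ within T₂∈ T₂⊆Z

subset-of-size : (q : Subset n) {m : ℕ} → m ≤ ∣ q ∣ → ∃[ S ] (S ⊆ q × ∣ S ∣ ≡ m)
subset-of-size {n} q m≤∣q∣ =
  let S , _ , S⊆q , ∣S∣ = interpolate (⊆-min q) (≤-trans (≤-reflexive (∣⊥∣≡0 n)) z≤n) m≤∣q∣ in S , S⊆q , ∣S∣

module _ {t : ℕ} {𝓣 : Family n} (int : Intersecting t 𝓣) (bnd : Bounded (t + 1) 𝓣) (t≤n : t ≤ n) where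

  -- The hypothesis is applied to an arbitrary `t`-set, to a `t`-subset of the resulting `T₀`, and
  -- to `T₀ ∩ T₁`; the three members obtained form a triangle.
  no-common⇒confined : (∀ S → ∣ S ∣ ≡ t → ∃[ V ] (V ∈ᶠ 𝓣 × ∃[ x ] (x ∈ S × x ∉ V))) →
    ∃[ Z ] (∣ Z ∣ ≡ t + 2 × (∀ V → V ∈ᶠ 𝓣 → V ⊆ Z × ∣ V ∣ ≡ t + 1))
  no-common⇒confined avoid =
    -- This `t`-set exists by `t≤n` and only serves to show that 𝓣 has a member.
    let S₀ , _ , ∣S₀∣ = subset-of-size ⊤ (≤-trans t≤n (≤-reflexive (sym (∣⊤∣≡n n))))
        T₀ , T₀∈ , _ = avoid S₀ ∣S₀∣
        S₁ , S₁⊆T₀ , ∣S₁∣ = subset-of-size T₀ (≤-trans (m≤m+n t 1) (≤-reflexive (sym (size T₀ T₀∈))))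
        T₁ , T₁∈ , y , y∈S₁ , y∉T₁ = avoid S₁ ∣S₁∣
        ∣T₀∩T₁∣≡t = meet T₀∈ T₁∈ (S₁⊆T₀ y∈S₁) y∉T₁
        T₂ , T₂∈ , x , x∈ , x∉T₂ = avoid (T₀ ∩ T₁) ∣T₀∩T₁∣≡t
    in assemble T₀∈ T₁∈ T₂∈ ∣T₀∩T₁∣≡t (p∩q⊆p T₀ T₁ x∈) (p∩q⊆q T₀ T₁ x∈) x∉T₂
    where
    size : ∀ V → V ∈ᶠ 𝓣 → ∣ V ∣ ≡ t + 1
    size V V∈ = ≤-antisym (bnd V V∈) (≤-trans (≤-reflexive (+-comm t 1)) (≤∧≢⇒< t≤∣V∣ ∣V∣≢t))
      where
      t≤∣V∣ : t ≤ ∣ V ∣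
      t≤∣V∣ = subst (λ p → t ≤ ∣ p ∣) (∩-idem V) (int V V V∈ V∈)
      -- A member with just `t` points would be contained in all the others and so be a common
      -- `t`-set.
      ∣V∣≢t : t ≢ ∣ V ∣
      ∣V∣≢t eq = let U , U∈ , x , x∈V , x∉U = avoid V (sym eq) in
        x∉U (∣p∣≤∣p∩q∣⇒p⊆q (subst (_≤ ∣ V ∩ U ∣) eq (int V U V∈ U∈)) x∈V)
    meet : ∀ {V U y} → V ∈ᶠ 𝓣 → U ∈ᶠ 𝓣 → y ∈ V → y ∉ U → ∣ V ∩ U ∣ ≡ t
    meet {V} {U} V∈ U∈ y∈V y∉U = ≤-antisym
      (s≤s⁻¹ (≰⇒> λ 1+t≤ → y∉U (∣p∣≤∣p∩q∣⇒p⊆q (≤-trans (≤-reflexive (trans (size V V∈) (+-comm t 1))) 1+t≤) y∈V)))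
      (int V U V∈ U∈)
    assemble : ∀ {T₀ T₁ T₂ x} → T₀ ∈ᶠ 𝓣 → T₁ ∈ᶠ 𝓣 → T₂ ∈ᶠ 𝓣 → ∣ T₀ ∩ T₁ ∣ ≡ t → x ∈ T₀ → x ∈ T₁ → x ∉ T₂ →
      ∃[ Z ] (∣ Z ∣ ≡ t + 2 × (∀ V → V ∈ᶠ 𝓣 → V ⊆ Z × ∣ V ∣ ≡ t + 1))
    assemble {T₀} {T₁} T₀∈ T₁∈ T₂∈ ∣∩∣ x∈T₀ x∈T₁ x∉T₂ = T₀ ∪ T₁ , ∣T₀∪T₁∣≡t+2 , λ V V∈ → confined V V∈ , size V V∈
      where open Triangle {𝓣 = 𝓣} int size T₀∈ T₁∈ T₂∈ ∣∩∣ x∈T₀ x∈T₁ x∉T₂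

  common-or-confined :
    (∃[ S ] (∣ S ∣ ≡ t × (∀ V → V ∈ᶠ 𝓣 → S ⊆ V))) ⊎
    (∃[ Z ] (∣ Z ∣ ≡ t + 2 × (∀ V → V ∈ᶠ 𝓣 → V ⊆ Z × ∣ V ∣ ≡ t + 1)))
  common-or-confined = decide (anySubset? λ S → ∣ S ∣ ≟ t ×-dec ¬? (misses? S))
    where
    misses? : ∀ S → Dec (∃[ V ] (V ∈ᶠ 𝓣 × ∃[ x ] (x ∈ S × x ∉ V)))
    misses? S = anySubset? λ V → T? (𝓣 V) ×-dec Fin.any? (λ x → x ∈? S ×-dec ¬? (x ∈? V))
    decide : Dec (∃[ S ] (∣ S ∣ ≡ t × ¬ (∃[ V ] (V ∈ᶠ 𝓣 × ∃[ x ] (x ∈ S × x ∉ V))))) → _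
    decide (yes (S , ∣S∣ , hit)) = inj₁ (S , ∣S∣ , λ V V∈ {x} x∈S →
      decidable-stable (x ∈? V) λ x∉V → hit (V , V∈ , x , x∈S , x∉V))
    decide (no ∄S) = inj₂ (no-common⇒confined λ S ∣S∣ → decidable-stable (misses? S) λ ∄V → ∄S (S , ∣S∣ , ∄V))

-- Diversity

∈-subsets : (A : Subset n) → A List.∈ subsets n
∈-subsets [] = Any.here refl
∈-subsets {suc n} (outside ∷ A) = ∈-++⁺ˡ (∈-map⁺ (outside ∷_) (∈-subsets A))
∈-subsets {suc n} (inside ∷ A) = ∈-++⁺ʳ (map (outside ∷_) (subsets n)) (∈-map⁺ (inside ∷_) (∈-subsets A))

avoiding : Subset n → Family n → Family n
avoiding S 𝓕 A = 𝓕 A ∧ not ⌊ S ⊆? A ⌋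

∈avoiding⁺ : {S A : Subset n} {𝓕 : Family n} → A ∈ᶠ 𝓕 → ¬ S ⊆ A → A ∈ᶠ avoiding S 𝓕
∈avoiding⁺ {S = S} {A} A∈𝓕 S⊈A with S ⊆? A
... | yes S⊆A = ⊥-elim (S⊈A S⊆A)
... | no _    = T-∧⁺ A∈𝓕 _

∈avoiding⁻ : {S A : Subset n} {𝓕 : Family n} → A ∈ᶠ avoiding S 𝓕 → A ∈ᶠ 𝓕 × ¬ S ⊆ A
∈avoiding⁻ {S = S} {A} A∈ with S ⊆? A
... | yes _   = ⊥-elim (proj₂ (T-∧⁻ A∈))
... | no S⊈A  = proj₁ (T-∧⁻ A∈) , S⊈A

card-partition : (p q : Family n) → card p ≡ card (λ A → p A ∧ q A) + card (λ A → p A ∧ not (q A))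
card-partition {n} p q = go (subsets n)
  where
  rearrange : ∀ a b c d → a + b + (c + d) ≡ a + c + (b + d)
  rearrange = solve-∀
  ι-split : ∀ a b → ι a ≡ ι (a ∧ b) + ι (a ∧ not b)
  ι-split false _ = refl
  ι-split true false = refl
  ι-split true true = refl
  go : ∀ xs → cnt p xs ≡ cnt (λ A → p A ∧ q A) xs + cnt (λ A → p A ∧ not (q A)) xs
  go [] = refl
  go (x ∷ xs) rewrite cnt-∷ p x xs | cnt-∷ (λ A → p A ∧ q A) x xs | cnt-∷ (λ A → p A ∧ not (q A)) x xs =
    trans (cong₂ _+_ (ι-split (p x) (q x)) (go xs)) (rearrange (ι (p x ∧ q x)) _ (cnt (λ A → p A ∧ q A) xs) _)

-- The diversity is the least number of members avoiding a `t`-set. This is the upper half of that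
-- description and `≤γ` the lower; together they remove `Δ` from the argument.
γ≤card-avoiding : {t : ℕ} (𝓕 : Family n) (S : Subset n) → ∣ S ∣ ≡ t → γ t 𝓕 ≤ card (avoiding S 𝓕)
γ≤card-avoiding {n} {t} 𝓕 S ∣S∣ = m≤n+o⇒m∸n≤o _ _ (begin
  card 𝓕                                         ≡⟨ card-partition 𝓕 (λ A → ⌊ S ⊆? A ⌋) ⟩
  card (star S 𝓕) + card (avoiding S 𝓕)          ≤⟨ +-monoˡ-≤ _ star≤Δ ⟩
  Δ t 𝓕 + card (avoiding S 𝓕)                    ∎)
  where
  open ≤-Reasoning
  star≤Δ : card (star S 𝓕) ≤ Δ t 𝓕
  star≤Δ = v≤max⁺ 0 _ (inj₂ (Any.map ≤-reflexive
    (∈-map⁺ (λ S → card (star S 𝓕)) (∈-filter⁺ (λ S → ∣ S ∣ ≟ t) (∈-subsets S) ∣S∣))))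

-- By `t ≤ n` there is at least one `t`-set, which yields `b ≤ card 𝓕` and makes `card 𝓕 ∸ b` an
-- exact difference.
≤γ : {t b : ℕ} (𝓕 : Family n) → t ≤ n → (∀ S → ∣ S ∣ ≡ t → b ≤ card (avoiding S 𝓕)) → b ≤ γ t 𝓕
≤γ {n} {t} {b} 𝓕 t≤n low = m+n≤o⇒m≤o∸n b (begin
  b + Δ t 𝓕              ≤⟨ +-monoʳ-≤ b Δ≤ ⟩
  b + (card 𝓕 ∸ b)       ≡⟨ m+[n∸m]≡n b≤card ⟩
  card 𝓕                 ∎)
  where
  open ≤-Reasoning
  star+b≤card : ∀ S → ∣ S ∣ ≡ t → card (star S 𝓕) + b ≤ card 𝓕
  star+b≤card S ∣S∣ = ≤-trans (+-monoʳ-≤ (card (star S 𝓕)) (low S ∣S∣))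
    (≤-reflexive (sym (card-partition 𝓕 (λ A → ⌊ S ⊆? A ⌋))))
  b≤card : b ≤ card 𝓕
  b≤card with S , _ , _ , ∣S∣ ← interpolate (⊆-min ⊤) (≤-trans (≤-reflexive (∣⊥∣≡0 n)) z≤n) (≤-trans t≤n (≤-reflexive (sym (∣⊤∣≡n n))))
    = ≤-trans (m≤n+m b _) (star+b≤card S ∣S∣)
  Δ≤ : Δ t 𝓕 ≤ card 𝓕 ∸ b
  Δ≤ = max≤v⁺ z≤n (All.map⁺ (All.tabulate λ {S} S∈ →
    m+n≤o⇒m≤o∸n _ (star+b≤card S (proj₂ (∈-filter⁻ (λ S → ∣ S ∣ ≟ t) {xs = subsets n} S∈)))))

∣initial∣ : {m : ℕ} → m ≤ n → ∣ initial n m ∣ ≡ m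
∣initial∣ {zero} z≤n = refl
∣initial∣ {suc n} {zero} z≤n = ∣initial∣ {n} z≤n
∣initial∣ {suc n} {suc m} (s≤s m≤n) = cong suc (trans
  (cong ∣_∣ (Vec.tabulate-cong λ (i : Fin n) → trans (isYes≗does (suc (toℕ i) <? suc m)) (sym (isYes≗does (toℕ i <? m)))))
  (∣initial∣ m≤n))

∈𝓐⁺ : {k t : ℕ} {Z A : Subset n} → ∣ A ∣ ≡ k → t + 1 ≤ ∣ A ∩ Z ∣ → A ∈ᶠ 𝓐[ Z ] k t
∈𝓐⁺ {k = k} {t} {Z} {A} ∣A∣ le = fromWitness {a? = (∣ A ∣ ≟ k) ×-dec (t + 1 ≤? ∣ A ∩ Z ∣)} (∣A∣ , le)

∈𝓐⁻ : {k t : ℕ} {Z A : Subset n} → A ∈ᶠ 𝓐[ Z ] k t → ∣ A ∣ ≡ k × t + 1 ≤ ∣ A ∩ Z ∣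
∈𝓐⁻ {k = k} {t} {Z} {A} A∈ = toWitness {a? = (∣ A ∣ ≟ k) ×-dec (t + 1 ≤? ∣ A ∩ Z ∣)} A∈

-- Members of a family avoiding a `t`-set, relative to Z

module Extremal {t s M n : ℕ} (n≡ : n ≡ t + (3 + M)) (Z : Subset n) (∣Z∣≡t+2 : ∣ Z ∣ ≡ t + 2) where

  private
    k : ℕ
    k = t + (2 + s)

    ∣Z-x∣≡t+1 : ∀ {x} → x ∈ Z → ∣ Z - x ∣ ≡ t + 1
    ∣Z-x∣≡t+1 x∈Z = suc-injective (trans (suc∣p-x∣≡∣p∣ x∈Z) (trans ∣Z∣≡t+2 (+-suc t 1)))

    ∣Z∪y∣≡t+3 : ∀ {y} → y ∉ Z → ∣ Z ∪ ⁅ y ⁆ ∣ ≡ t + 3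
    ∣Z∪y∣≡t+3 y∉Z = trans (∣p∪⁅x⁆∣≡suc∣p∣ y∉Z) (trans (cong suc ∣Z∣≡t+2) (sym (+-suc t 2)))

    complete : ∀ {m} a b c → m ≡ t + a → a + b ≡ c → m + b ≡ t + c
    complete a b c refl refl = +-assoc t a b

  card-missing : ∀ {x} → x ∈ Z → card (traces k Z (Z - x)) ≡ suc M C suc s
  card-missing {x} x∈Z = card-traces (p-x⊆p Z x)
    (complete 1 (suc s) (2 + s) (∣Z-x∣≡t+1 x∈Z) refl)
    (trans (complete 2 (suc M) (3 + M) ∣Z∣≡t+2 refl) (sym n≡))

  card-missing-∌ : ∀ {x y} → x ∈ Z → y ∉ Z → card (traces k (Z ∪ ⁅ y ⁆) (Z - x)) ≡ M C suc s
  card-missing-∌ {x} {y} x∈Z y∉Z = card-traces (p⊆p∪q ⁅ y ⁆ ∘ p-x⊆p Z x)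
    (complete 1 (suc s) (2 + s) (∣Z-x∣≡t+1 x∈Z) refl)
    (trans (complete 3 M (3 + M) (∣Z∪y∣≡t+3 y∉Z) refl) (sym n≡))

  card-missing-∋ : ∀ {x y} → x ∈ Z → y ∉ Z → card (traces k (Z ∪ ⁅ y ⁆) ((Z - x) ∪ ⁅ y ⁆)) ≡ M C s
  card-missing-∋ {x} {y} x∈Z y∉Z = card-traces
    (∪-⊆ (p⊆p∪q ⁅ y ⁆ ∘ p-x⊆p Z x) (q⊆p∪q Z ⁅ y ⁆))
    (complete 2 s (2 + s) (trans (∣p∪⁅x⁆∣≡suc∣p∣ (y∉Z ∘ p-x⊆p Z x)) (trans (cong suc (∣Z-x∣≡t+1 x∈Z)) (sym (+-suc t 1)))) refl)
    (trans (complete 3 M (3 + M) (∣Z∪y∣≡t+3 y∉Z) refl) (sym n≡))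

  -- With |Z| = t + 2 and |A ∩ Z| ≥ t + 1, a single point of `Z` missing from `A` already determines
  -- the trace.
  missing-point : ∀ {S A} → S ⊆ Z → ¬ S ⊆ A → t + 1 ≤ ∣ A ∩ Z ∣ → ∃[ x ] (x ∈ S × A ∩ Z ≡ Z - x)
  missing-point {S} {A} S⊆Z S⊈A le with ⊆-or-witness S A
  ... | inj₁ S⊆A = ⊥-elim (S⊈A S⊆A)
  ... | inj₂ (x , x∈S , x∉A) = x , x∈S ,
    ⊆∧∣∣≥⇒≡ (λ y∈ → x∈p∧x≢y⇒x∈p-y (p∩q⊆q A Z y∈) λ { refl → x∉A (p∩q⊆p A Z y∈) })
      (≤-trans (≤-reflexive (∣Z-x∣≡t+1 (S⊆Z x∈S))) le)

  Z-injective : ∀ {x y} → x ∈ Z → Z - x ≡ Z - y → x ≡ y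
  Z-injective {x} {y} x∈Z eq with x Fin.≟ y
  ... | yes x≡y = x≡y
  ... | no  x≢y = ⊥-elim (x∈p-y⇒x≢y {p = Z} (subst (x ∈_) (sym eq) (x∈p∧x≢y⇒x∈p-y x∈Z x≢y)) refl)

  missing⇒∈avoiding : ∀ {S A x} → x ∈ S → x ∈ Z → ∣ A ∣ ≡ k → A ∩ Z ≡ Z - x → A ∈ᶠ avoiding S (𝓐[ Z ] k t)
  missing⇒∈avoiding {S} {A} {x} x∈S x∈Z ∣A∣ eq = ∈avoiding⁺ {𝓕 = 𝓐[ Z ] k t}
    (∈𝓐⁺ {k = k} {t} {Z} {A} ∣A∣ (≤-reflexive (sym (trans (cong ∣_∣ eq) (∣Z-x∣≡t+1 x∈Z)))))
    λ S⊆A → x∈p-y⇒x≢y {p = Z} (subst (x ∈_) eq (x∈p∩q⁺ (S⊆A x∈S , x∈Z))) refl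

  -- For `S ⊆ Z`, the sets missing exactly one point of `Z`, a point of `S`, form `t` disjoint
  -- classes of size D. If some `y` in `S` is outside `Z`, every set without `y` avoids `S`, so all
  -- t + 2 missing points are available, each with C(N-3,r-1) sets.
  card-avoiding-𝓐 : t * (suc M C suc s) ≤ (t + 2) * (M C suc s) →
    ∀ S → ∣ S ∣ ≡ t → t * (suc M C suc s) ≤ card (avoiding S (𝓐[ Z ] k t))
  card-avoiding-𝓐 le S ∣S∣ with ⊆-or-witness S Z
  ... | inj₁ S⊆Z = subst (λ m → m * (suc M C suc s) ≤ card (avoiding S (𝓐[ Z ] k t))) ∣S∣
    (disjoint-union-points S (λ x → traces k Z (Z - x)) (avoiding S (𝓐[ Z ] k t)) (suc M C suc s)
      (λ x x∈S → ≤-reflexive (sym (card-missing (S⊆Z x∈S))))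
      (λ {x} {A} x∈S A∈ → let ∣A∣ , eq = ∈traces⁻ {k = k} {Z} {Z - x} {A} A∈ in
        missing⇒∈avoiding x∈S (S⊆Z x∈S) ∣A∣ eq)
      λ {x} {y} {A} x∈S y∈S A∈x A∈y → Z-injective (S⊆Z x∈S)
        (trans (sym (proj₂ (∈traces⁻ {k = k} {Z} {Z - x} {A} A∈x))) (proj₂ (∈traces⁻ {k = k} {Z} {Z - y} {A} A∈y))))
  ... | inj₂ (y , y∈S , y∉Z) = ≤-trans le (subst (λ m → m * (M C suc s) ≤ card (avoiding S (𝓐[ Z ] k t))) ∣Z∣≡t+2
    (disjoint-union-points Z Φ (avoiding S (𝓐[ Z ] k t)) (M C suc s)
      (λ x x∈Z → ≤-reflexive (sym (card-missing-∌ x∈Z y∉Z)))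
      (λ {x} {A} x∈Z A∈ → ∈avoiding⁺ {𝓕 = 𝓐[ Z ] k t}
        (∈𝓐⁺ {k = k} {t} {Z} {A} (proj₁ (members {x} {A} A∈)) (≤-reflexive (sym (trans (cong ∣_∣ (trace {x} {A} A∈)) (∣Z-x∣≡t+1 x∈Z)))))
        λ S⊆A → y∉Z (p-x⊆p Z x (subst (y ∈_) (proj₂ (members {x} {A} A∈)) (x∈p∩q⁺ (S⊆A y∈S , q⊆p∪q Z ⁅ y ⁆ (x∈⁅x⁆ y))))))
      λ {x} {x′} {A} x∈Z _ A∈x A∈x′ → Z-injective x∈Z (trans (sym (trace {x} {A} A∈x)) (trace {x′} {A} A∈x′))))
    where
    Φ : Fin n → Family n
    Φ x = traces k (Z ∪ ⁅ y ⁆) (Z - x)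
    members : ∀ {x A} → A ∈ᶠ Φ x → ∣ A ∣ ≡ k × A ∩ (Z ∪ ⁅ y ⁆) ≡ Z - x
    members {x} {A} = ∈traces⁻ {k = k} {Z ∪ ⁅ y ⁆} {Z - x} {A}
    trace : ∀ {x A} → A ∈ᶠ Φ x → A ∩ Z ≡ Z - x
    trace {x} {A} A∈ = begin
      A ∩ Z                          ≡⟨ cong (A ∩_) (trans (∩-comm (Z ∪ ⁅ y ⁆) Z) (p⊆q⇒p∩q≡p (p⊆p∪q ⁅ y ⁆))) ⟨
      A ∩ ((Z ∪ ⁅ y ⁆) ∩ Z)          ≡⟨ ∩-assoc A (Z ∪ ⁅ y ⁆) Z ⟨
      (A ∩ (Z ∪ ⁅ y ⁆)) ∩ Z          ≡⟨ cong (_∩ Z) (proj₂ (members {x} {A} A∈)) ⟩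
      (Z - x) ∩ Z                    ≡⟨ p⊆q⇒p∩q≡p (p-x⊆p Z x) ⟩
      Z - x                          ∎
      where open ≡-Reasoning

  module _ {𝓕 : Family n} (uni : Uniform k 𝓕) where

    card-avoiding-⊆𝓐 : 𝓕 ⊆ᶠ 𝓐[ Z ] k t → ∀ {S} → S ⊆ Z → ∣ S ∣ ≡ t → card (avoiding S 𝓕) ≤ t * (suc M C suc s)
    card-avoiding-⊆𝓐 𝓕⊆𝓐 {S} S⊆Z ∣S∣ = subst (λ m → card (avoiding S 𝓕) ≤ m * (suc M C suc s)) ∣S∣
      (union-bound-points S (λ x → traces k Z (Z - x)) (avoiding S 𝓕) (suc M C suc s)
        (λ x x∈S → ≤-reflexive (card-missing (S⊆Z x∈S)))
        λ A A∈ → let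
            A∈𝓕 , S⊈A = ∈avoiding⁻ {𝓕 = 𝓕} A∈
            x , x∈S , eq = missing-point S⊆Z S⊈A (proj₂ (∈𝓐⁻ {k = k} {t} {Z} {A} (𝓕⊆𝓐 A A∈𝓕)))
          in x , x∈S , ∈traces⁺ (uni A A∈𝓕) eq)

    -- Each x ∈ S satisfies |G ∩ (Z - x)| < t, so the members A of 𝓕 with A ∩ Z = Z - x meet G outside Z.
    card-avoiding-⊈𝓐 : Intersecting t 𝓕 → (𝓤 : Family n) →
      (∀ A → A ∈ᶠ 𝓕 → A ∈ᶠ 𝓤 ⊎ t + 1 ≤ ∣ A ∩ Z ∣) →
      ∀ {G S} → G ∈ᶠ 𝓕 → G ∩ Z ⊆ S → S ⊆ Z → ∣ S ∣ ≡ t →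
      card (avoiding S 𝓕) ≤ card 𝓤 + t * (k * (M C s))
    card-avoiding-⊈𝓐 int 𝓤 cover {G} {S} G∈ G∩Z⊆S S⊆Z ∣S∣ = ≤-trans
      (card-cover (avoiding S 𝓕) 𝓤 𝓡 λ A A∈ → let A∈𝓕 , S⊈A = ∈avoiding⁻ {𝓕 = 𝓕} A∈ in
        case cover A A∈𝓕 of λ
          { (inj₁ A∈𝓤) → inj₁ A∈𝓤
          ; (inj₂ le)  → inj₂ (fromWitness {a? = T? (𝓕 A) ×-dec ¬? (S ⊆? A) ×-dec t + 1 ≤? ∣ A ∩ Z ∣} (A∈𝓕 , S⊈A , le)) })
      (+-monoʳ-≤ (card 𝓤) (subst (λ m → card 𝓡 ≤ m * (k * (M C s))) ∣S∣
        (union-bound-points S (λ x → missing x) 𝓡 (k * (M C s)) card-missing≤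
          λ A A∈ → let
              A∈𝓕 , S⊈A , le = toWitness {a? = T? (𝓕 A) ×-dec ¬? (S ⊆? A) ×-dec t + 1 ≤? ∣ A ∩ Z ∣} A∈
              x , x∈S , eq = missing-point S⊆Z S⊈A le
            in x , x∈S , fromWitness {a? = T? (𝓕 A) ×-dec A ∩ Z ≟ˢ Z - x} (A∈𝓕 , eq))))
      where
      𝓡 : Family n
      𝓡 A = ⌊ T? (𝓕 A) ×-dec ¬? (S ⊆? A) ×-dec t + 1 ≤? ∣ A ∩ Z ∣ ⌋
      missing : Fin n → Family n
      missing x A = ⌊ T? (𝓕 A) ×-dec A ∩ Z ≟ˢ Z - x ⌋
      ∣[Z-x]∩G∣<t : ∀ x → x ∈ S → ∣ (Z - x) ∩ G ∣ < t
      -- As G ∩ Z is inside `S`, this intersection is inside `S` and omits `x`.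
      ∣[Z-x]∩G∣<t x x∈S = subst (∣ (Z - x) ∩ G ∣ <_) ∣S∣ (p⊂q⇒∣p∣<∣q∣
        ((λ y∈ → G∩Z⊆S (x∈p∩q⁺ (p∩q⊆q (Z - x) G y∈ , p-x⊆p Z x (p∩q⊆p (Z - x) G y∈)))) ,
         x , x∈S , λ x∈ → x∈p-y⇒x≢y {p = Z} (p∩q⊆p (Z - x) G x∈) refl))
      card-missing≤ : ∀ x → x ∈ S → card (missing x) ≤ k * (M C s)
      card-missing≤ x x∈S = ≤-trans
        -- There are at most |G| = k choices of `g`, and each one fixes a further point outside `Z`.
        (union-bound-points (G ─ Z) (λ g → traces k (Z ∪ ⁅ g ⁆) ((Z - x) ∪ ⁅ g ⁆)) (missing x) (M C s)
          (λ g g∈ → ≤-reflexive (card-missing-∋ (S⊆Z x∈S) (x∈p─q⇒x∉q G Z g∈)))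
          meets)
        (*-monoˡ-≤ (M C s) (≤-trans (∣p─q∣≤∣p∣ G Z) (≤-reflexive (uni G G∈))))
        where
        meets : ∀ A → A ∈ᶠ missing x → ∃[ g ] (g ∈ G ─ Z × A ∈ᶠ traces k (Z ∪ ⁅ g ⁆) ((Z - x) ∪ ⁅ g ⁆))
        meets A A∈ with toWitness {a? = T? (𝓕 A) ×-dec A ∩ Z ≟ˢ Z - x} A∈ | ⊆-or-witness (A ∩ G) Z
        ... | A∈𝓕 , eq | inj₁ A∩G⊆Z = ⊥-elim (<⇒≱ (∣[Z-x]∩G∣<t x x∈S) (≤-trans (int A G A∈𝓕 G∈)
          (p⊆q⇒∣p∣≤∣q∣ λ {y} y∈ → x∈p∩q⁺ (subst (y ∈_) eq (x∈p∩q⁺ (p∩q⊆p A G y∈ , A∩G⊆Z y∈)) , p∩q⊆q A G y∈))))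
        ... | A∈𝓕 , eq | inj₂ (g , g∈ , g∉Z) = g , x∈p∧x∉q⇒x∈p─q (p∩q⊆q A G g∈) g∉Z , ∈traces⁺ (uni A A∈𝓕)
          (trans (∩-distribˡ-∪ A Z ⁅ g ⁆) (cong₂ _∪_ eq (trans (∩-comm A ⁅ g ⁆) (p⊆q⇒p∩q≡p (⁅x⁆⊆ (p∩q⊆p A G g∈))))))

-- From a kernel of sets of size at most t + 1 to the diversity of 𝓕

module _ {t s M n tail : ℕ} (n≡ : n ≡ t + (3 + M))
  (tD≤γ𝓐 : t * (suc M C suc s) ≤ γ t (𝓐 n (t + (2 + s)) t))
  (small : tail + t * ((t + (2 + s)) * (M C s)) < t * (suc M C suc s))
  {𝓕 : Family n} (uni : Uniform (t + (2 + s)) 𝓕) (int : Intersecting t 𝓕)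
  {𝓣 : Family n} (intᵗ : Intersecting t 𝓣) (bndᵗ : Bounded (t + 1) 𝓣) (le : card (uncovered 𝓣 𝓕) ≤ tail) where

  private
    k D : ℕ
    k = t + (2 + s)
    D = suc M C suc s

    Conclusion : Set
    Conclusion = (γ t 𝓕 ≤ γ t (𝓐 n k t)) ×
      (γ t 𝓕 ≡ γ t (𝓐 n k t) → ∃[ Z ] (∣ Z ∣ ≡ t + 2 × 𝓕 ⊆ᶠ 𝓐[ Z ] k t))

    -- A strict bound settles both claims, since equality is then impossible.
    below-extremal : γ t 𝓕 < t * D → Conclusion
    below-extremal lt = <⇒≤ (<-≤-trans lt tD≤γ𝓐) , λ eq → ⊥-elim (<⇒≢ (<-≤-trans lt tD≤γ𝓐) eq)

    choose-t : ∀ {p q : Subset n} → p ⊆ q → ∣ p ∣ ≤ t → ∣ q ∣ ≡ t + 2 → ∃[ S ] (p ⊆ S × S ⊆ q × ∣ S ∣ ≡ t)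
    choose-t p⊆q ∣p∣≤t ∣q∣ = interpolate p⊆q ∣p∣≤t (≤-trans (m≤m+n t 2) (≤-reflexive (sym ∣q∣)))

    -- A member of 𝓕 not containing `S` contains no set of 𝓣, so it is among those lost in the
    -- peeling.
    common-case : ∀ S → ∣ S ∣ ≡ t → (∀ V → V ∈ᶠ 𝓣 → S ⊆ V) → γ t 𝓕 < t * D
    common-case S ∣S∣ S⊆ = begin-strict
      γ t 𝓕                         ≤⟨ γ≤card-avoiding 𝓕 S ∣S∣ ⟩
      card (avoiding S 𝓕)           ≤⟨ card-mono {𝓕 = avoiding S 𝓕} {uncovered 𝓣 𝓕} (λ A A∈ → let A∈𝓕 , S⊈A = ∈avoiding⁻ {𝓕 = 𝓕} A∈ in
                                         ∈uncovered⁺ {𝓣 = 𝓣} {𝓕} A∈𝓕 λ { (V , V∈ , V⊆A) → S⊈A (V⊆A ∘ S⊆ V V∈) }) ⟩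
      card (uncovered 𝓣 𝓕)          ≤⟨ le ⟩
      tail                          ≤⟨ m≤m+n tail _ ⟩
      tail + t * (k * (M C s))      <⟨ small ⟩
      t * D                         ∎
      where open ≤-Reasoning

    module Confined (Z : Subset n) (∣Z∣ : ∣ Z ∣ ≡ t + 2) (⊆Z : ∀ V → V ∈ᶠ 𝓣 → V ⊆ Z × ∣ V ∣ ≡ t + 1) where

      open Extremal {t} {s} {M} n≡ Z ∣Z∣

      inside-case : 𝓕 ⊆ᶠ 𝓐[ Z ] k t → γ t 𝓕 ≤ t * D
      inside-case 𝓕⊆𝓐 =
        let S , _ , S⊆Z , ∣S∣ = choose-t (⊆-min Z) (≤-trans (≤-reflexive (∣⊥∣≡0 n)) z≤n) ∣Z∣ in
        ≤-trans (γ≤card-avoiding 𝓕 S ∣S∣) (card-avoiding-⊆𝓐 uni 𝓕⊆𝓐 S⊆Z ∣S∣)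

      -- |G ∩ Z| ≤ t leaves room for a `t`-set between G ∩ Z and `Z`. This centre, adapted to `G`,
      -- makes the sets avoiding it rare.
      outside-case : ∀ G → G ∈ᶠ 𝓕 → ¬ (t + 1 ≤ ∣ G ∩ Z ∣) → γ t 𝓕 < t * D
      outside-case G G∈ t+1≰ =
        let S , G∩Z⊆S , S⊆Z , ∣S∣ = choose-t (p∩q⊆q G Z) (s≤s⁻¹ (≤-trans (≰⇒> t+1≰) (≤-reflexive (+-comm t 1)))) ∣Z∣ in
        begin-strict
        γ t 𝓕                                           ≤⟨ γ≤card-avoiding 𝓕 S ∣S∣ ⟩
        card (avoiding S 𝓕)                             ≤⟨ card-avoiding-⊈𝓐 uni int (uncovered 𝓣 𝓕) cover G∈ G∩Z⊆S S⊆Z ∣S∣ ⟩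
        card (uncovered 𝓣 𝓕) + t * (k * (M C s))        ≤⟨ +-monoˡ-≤ (t * (k * (M C s))) le ⟩
        tail + t * (k * (M C s))                        <⟨ small ⟩
        t * D                                           ∎
        where
        open ≤-Reasoning
        cover : ∀ A → A ∈ᶠ 𝓕 → A ∈ᶠ uncovered 𝓣 𝓕 ⊎ t + 1 ≤ ∣ A ∩ Z ∣
        cover A A∈ with toSum (covers? 𝓣 A)
        ... | inj₂ ∅ = inj₁ (∈uncovered⁺ {𝓣 = 𝓣} {𝓕} A∈ ∅)
        ... | inj₁ (V , V∈ , V⊆A) = inj₂ (≤-trans (≤-reflexive (sym (proj₂ (⊆Z V V∈))))
          (p⊆q⇒∣p∣≤∣q∣ (⊆-∩ V⊆A (proj₁ (⊆Z V V∈)))))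

      conclude : Dec (∃[ G ] (G ∈ᶠ 𝓕 × ¬ G ∈ᶠ 𝓐[ Z ] k t)) → Conclusion
      conclude (yes (G , G∈ , G∉)) = below-extremal (outside-case G G∈ λ t+1≤ → G∉ (∈𝓐⁺ {k = k} {t} {Z} {G} (uni G G∈) t+1≤))
      conclude (no ∄G) = ≤-trans (inside-case 𝓕⊆𝓐) tD≤γ𝓐 , λ _ → Z , ∣Z∣ , 𝓕⊆𝓐
        where
        𝓕⊆𝓐 : 𝓕 ⊆ᶠ 𝓐[ Z ] k t
        𝓕⊆𝓐 A A∈ = decidable-stable (T? (𝓐[ Z ] k t A)) λ A∉ → ∄G (A , A∈ , A∉)

  diversity-from-kernel : Conclusion
  diversity-from-kernel =
    [ (λ { (S , ∣S∣ , S⊆) → below-extremal (common-case S ∣S∣ S⊆) })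
    , (λ { (Z , ∣Z∣ , ⊆Z) → Confined.conclude Z ∣Z∣ ⊆Z (anySubset? λ G → T? (𝓕 G) ×-dec ¬? (T? (𝓐[ Z ] k t G))) })
    ]′ (common-or-confined intᵗ bndᵗ (subst (t ≤_) (sym n≡) (m≤m+n t (3 + M))))

diversity-bound : {t s M n : ℕ} (n≡ : n ≡ t + (3 + M)) (2≤t : 2 ≤ t)
  (N≥18[t+2]r : 18 * (t + 2) * (2 + s) ≤ 3 + M)
  (N≥2ekr : ∀ m → 2 * suc m ^ m * (t + (2 + s)) * (2 + s) ≤ m ^ m * (3 + M))
  {𝓕 : Family n} (uni : Uniform (t + (2 + s)) 𝓕) (int : Intersecting t 𝓕) →
  (γ t 𝓕 ≤ γ t (𝓐 n (t + (2 + s)) t)) ×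
  (γ t 𝓕 ≡ γ t (𝓐 n (t + (2 + s)) t) → ∃[ Z ] (∣ Z ∣ ≡ t + 2 × 𝓕 ⊆ᶠ 𝓐[ Z ] (t + (2 + s)) t))
diversity-bound {t} {s} {M} {n} n≡ 2≤t N≥18[t+2]r N≥2ekr {𝓕} uni int =
  let 𝓣 , intᵗ , bndᵗ , le = Peeling.kernel n≡ r≤N (levelMass-halves N≥2ekr r≤N) uni int (s≤s (s≤s z≤n)) in
  diversity-from-kernel n≡ tD≤γ𝓐
    (2*levelMass₂+tk[N-3]C[r-2]<t*[N-2]C[r-1] 2≤t N≥18[t+2]r N≥2ekr) uni int {𝓣} intᵗ bndᵗ le
  where
  r≤N : 2 + s ≤ 3 + M
  r≤N = ≤-trans (m≤n*m (2 + s) (18 * (t + 2)) {{m*n≢0 18 (t + 2) {{_}} {{>-nonZero (≤-trans (s≤s z≤n) (m≤n+m 2 t))}}}}) N≥18[t+2]r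
  tD≤γ𝓐 : t * (suc M C suc s) ≤ γ t (𝓐 n (t + (2 + s)) t)
  tD≤γ𝓐 = ≤γ (𝓐 n (t + (2 + s)) t) (subst (t ≤_) (sym n≡) (m≤m+n t (3 + M)))
    (Extremal.card-avoiding-𝓐 {t} {s} {M} n≡ (initial n (t + 2))
      (∣initial∣ (subst (t + 2 ≤_) (sym n≡) (+-monoʳ-≤ t (s≤s (s≤s z≤n)))))
      (t*[N-2]C[r-1]≤[t+2]*[N-3]C[r-1] 2≤t N≥18[t+2]r N≥2ekr))

split-≤ : ∀ a b {c} → a + b ≤ c → ∃[ d ] a + (b + d) ≡ c
split-≤ a b {c} le = c ∸ (a + b) , trans (sym (+-assoc a b _)) (m+[n∸m]≡n le)

3≤18[t+2][2+s] : ∀ t s → 3 ≤ 18 * (t + 2) * (2 + s)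
3≤18[t+2][2+s] t s = ≤-trans (m≤m+n 3 (69 + 36 * (s + t) + 18 * (s * t))) (≤-reflexive (expand t s))
  where
  expand : ∀ t s → 3 + (69 + 36 * (s + t) + 18 * (s * t)) ≡ 18 * (t + 2) * (2 + s)
  expand = solve-∀

diversity-bound-of-e : {n t s : ℕ} → 2 ≤ t → fromℕ n ≥[e] bound (t + (2 + s)) t →
  {𝓕 : Family n} → Uniform (t + (2 + s)) 𝓕 → Intersecting t 𝓕 →
  (γ t 𝓕 ≤ γ t (𝓐 n (t + (2 + s)) t)) ×
  (γ t 𝓕 ≡ γ t (𝓐 n (t + (2 + s)) t) → ∃[ Z ] (∣ Z ∣ ≡ t + 2 × 𝓕 ⊆ᶠ 𝓐[ Z ] (t + (2 + s)) t))
diversity-bound-of-e {n} {t} {s} 2≤t n≥bound uni int =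
  let M , t+[3+M]≡n = split-≤ t 3 (≤-trans (+-monoʳ-≤ t (3≤18[t+2][2+s] t s)) linear) in
  diversity-bound (sym t+[3+M]≡n) 2≤t
    (+-cancelˡ-≤ t _ _ (≤-trans linear (≤-reflexive (sym t+[3+M]≡n))))
    (λ m → subst (λ N → 2 * suc m ^ m * (t + (2 + s)) * (2 + s) ≤ m ^ m * N)
      (trans (cong (_∸ t) (sym t+[3+M]≡n)) (m+n∸m≡n t (3 + M)))
      (bound⇒2[1+m]^mkr≤m^m[n∸t] {n} {t} {2 + s} n≥bound m))
    uni int
  where
  linear : t + 18 * (t + 2) * (2 + s) ≤ n
  linear = bound⇒t+18[t+2]r≤n {n} {t} {2 + s} n≥bound

corollary1p11 : ∀ (n k t : ℕ) → t + 2 ≤ k → 4 ≤ t + 2 →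
    fromℕ n ≥[e] bound k t →
    ∀ (𝓕 : Family n) → Uniform k 𝓕 → Intersecting t 𝓕 →
    (γ t 𝓕 ≤ γ t (𝓐 n k t))
    × (γ t 𝓕 ≡ γ t (𝓐 n k t) →
    ∃[ Z ] (∣ Z ∣ ≡ t + 2 × 𝓕 ⊆ᶠ 𝓐[ Z ] k t))
corollary1p11 n k t t+2≤k 4≤t+2 n≥bound 𝓕 uni int = from-split (split-≤ t 2 t+2≤k) n≥bound uni
  where
  from-split : ∀ {k} → ∃[ s ] t + (2 + s) ≡ k → fromℕ n ≥[e] bound k t → Uniform k 𝓕 →
    (γ t 𝓕 ≤ γ t (𝓐 n k t)) ×
    (γ t 𝓕 ≡ γ t (𝓐 n k t) → ∃[ Z ] (∣ Z ∣ ≡ t + 2 × 𝓕 ⊆ᶠ 𝓐[ Z ] k t))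
  from-split (s , refl) n≥bound uni = diversity-bound-of-e {s = s} (+-cancelʳ-≤ 2 2 t 4≤t+2) n≥bound uni int
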